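{- Let $\mathbf{s}=(s_1,\ldots,s_n)$ be a sequence of positive integers with $\gcd(s_i,s_{i+1})=1$ for $1\leq i<n$. Then the $h^*$-vector of $\mathcal{R}_n^{(\mathbf{s})}$ is symmetric if and only if $\mathbf{s}$ is $\mathbf{u}$-generated by some sequence $\mathbf{u}=(u_1,\ldots,u_{n-1})$ of positive integers.
   Context: A sequence $\mathbf{s}$ is $\mathbf{u}$-generated by a sequence $\mathbf{u}$ of positive integers if $s_2=u_1s_1-1$ and $s_{i+1}=u_is_i-s_{i-1}$ for $i>1$. Let $\mathcal{C}_n^{(\mathbf{s})}=\{\lambda\in\mathbb{R}^n: 0\leq\lambda_1/s_1\leq\cdots\leq\lambda_n/s_n\}$, $\mathcal{L}_n^{(\mathbf{s})}=\mathcal{C}_n^{(\mathbf{s})}\cap\mathbb{Z}^n$, and $\mathcal{R}_n^{(\mathbf{s})}=\{\lambda\in\mathcal{C}_n^{(\mathbf{s})}:\lambda_n\leq1\}$. For integers $t\geq0$ let $i(\mathcal{R}_n^{(\mathbf{s})},t)=|\{\lambda\in\mathcal{L}_n^{(\mathbf{s})}:\lambda_n\leq t\}|$ and $\mathcal{E}_n^{(\mathbf{s})}(x)=\sum_{t\geq0}i(\mathcal{R}_n^{(\mathbf{s})},t)x^t$. It is known that $Q_n^{(\mathbf{s})}(x):=(1-x^{s_n})^{n+1}\mathcal{E}_n^{(\mathbf{s})}(x)$ is a polynomial; its coefficient sequence is the $h^*$-vector of $\mathcal{R}_n^{(\mathbf{s})}$, which is called symmetric if it reads the same from left to right as from right to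 left. -}

module Defs where

open import Data.Nat as ℕ using (ℕ; zero; suc; _+_; _*_; _∸_; _≤_; _<_; _≤?_)
open import Data.Nat.Combinatorics using (_C_)
open import Data.Integer as ℤ using (ℤ; +_)
open import Data.List using (List; []; _∷_; map; concatMap; filter; length; upTo; foldr)

open import Relation.Nullary.Decidable using (T?)
open import Data.Vec using (Vec; []; _∷_)
open import Data.Bool using (Bool; true; false; _∧_)
open import Relation.Nullary.Decidable using (⌊_⌋; yes; no)

-- Conventions: sequences s, u are 1-indexed functions ℕ → ℕ; only the values
-- at indices 1..n (resp. 1..n-1) matter.

-- 1-based access into a vector (0 outside the range 1..n).
at : ∀ {n} → Vec ℕ n → ℕ → ℕ
at []       _             = 0
at (x ∷ xs) zero          = 0
at (x ∷ xs) (suc zero)    = x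
at (x ∷ xs) (suc (suc i)) = at xs (suc i)

box : (n B : ℕ) → List (Vec ℕ n)
box zero    B = [] ∷ []
box (suc n) B = concatMap (λ x → map (x ∷_) (box n B)) (upTo (suc B))

sumFrom : ℕ → ℕ → (ℕ → ℕ) → ℕ
sumFrom a zero    f = 0
sumFrom a (suc k) f = f a + sumFrom (suc a) k f

-- λ ∈ 𝓛_n^(s) : 0 ≤ λ₁/s₁ ≤ ⋯ ≤ λₙ/sₙ, i.e. λᵢ·s_{i+1} ≤ λ_{i+1}·sᵢ for 1 ≤ i < n
-- (λ ∈ ℕ^n encodes the nonnegativity; s is positive)
inCone : (n : ℕ) → (ℕ → ℕ) → Vec ℕ n → Bool
inCone n s λv = foldr (λ b acc → b ∧ acc) true (map (λ j → ⌊ at λv (suc j) * s (suc (suc j)) ≤? at λv (suc (suc j)) * s (suc j) ⌋)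
                    (upTo (n ∸ 1)))

-- i(𝓡_n^(s), t) = |{λ ∈ 𝓛_n^(s) : λₙ ≤ t}|.
-- Every such λ satisfies λᵢ ≤ t·sᵢ/sₙ ≤ t·(s₁+⋯+sₙ), so it lies in the box
-- {0,…,t·(s₁+⋯+sₙ)}^n which we enumerate.
ehr : (n : ℕ) → (ℕ → ℕ) → ℕ → ℕ
ehr n s t = length (filter (λ λv → T? (inCone n s λv ∧ ⌊ at λv n ≤? t ⌋))
                           (box n (t * sumFrom 1 n s)))

sgn : ℕ → ℤ
sgn zero          = ℤ.+ 1
sgn (suc zero)    = ℤ.- (ℤ.+ 1)
sgn (suc (suc j)) = sgn j

-- coefficient of x^k in  Q_n^(s)(x) = (1 - x^{sₙ})^{n+1} · Σ_t i(𝓡,t) x^t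
--   = Σ_{j=0}^{n+1} (-1)^j C(n+1,j) · i(𝓡, k - j·sₙ)   (terms with j·sₙ > k omitted)
hstar : (n : ℕ) → (ℕ → ℕ) → ℕ → ℤ
hstar n s k = go (suc (suc n))
  where
  term : ℕ → ℤ
  term j with j * s n ≤? k
  ... | yes _ = sgn j ℤ.* (+ ((suc n) C j)) ℤ.* (+ ehr n s (k ∸ j * s n))
  ... | no  _ = + 0
  go : ℕ → ℤ
  go zero    = + 0
  go (suc m) = go m ℤ.+ term m

open import Data.Product using (Σ; _×_; ∃)
open import Relation.Binary.PropositionalEquality using (_≡_; _≢_)

-- The h*-vector of 𝓡_n^(s) is the coefficient sequence (h₀,…,h_d) of the
-- polynomial Q_n^(s) of degree d; it is symmetric iff h_k = h_{d-k} for k ≤ d.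
HStarSymmetric : (n : ℕ) → (ℕ → ℕ) → Set
HStarSymmetric n s =
  Σ ℕ λ d → (hstar n s d ≢ + 0)
          × (∀ k → d < k → hstar n s k ≡ + 0)
          × (∀ k → k ≤ d → hstar n s k ≡ hstar n s (d ∸ k))

UGenerated : (n : ℕ) → (u s : ℕ → ℕ) → Set
UGenerated n u s =
    (2 ≤ n → + s 2 ≡ (+ u 1 ℤ.* + s 1) ℤ.- + 1)
  × (∀ i → 2 ≤ i → i < n → + s (suc i) ≡ (+ u i ℤ.* + s i) ℤ.- + s (i ∸ 1))

{-# OPTIONS --safe #-}

-- Let f(t) and g(t) count the lattice points of the cone and of its interior with last
-- coordinate t. Passing from n to n+1 coordinates sums these counts up to ⌊t sₙ/sₙ₊₁⌋
-- and ⌊(t sₙ − 1)/sₙ₊₁⌋ respectively. As ⌊(−a − 1)/q⌋ = −1 − ⌊a/q⌋, both recursions are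
-- the two halves of one recursion for quasi-polynomials on ℤ, which gives Ehrhart–Macdonald
-- reciprocity by induction. Hence h* is symmetric iff g is a translate of f, say by b.
-- If c is the interior point with last coordinate b, then translation by c maps the
-- cone injectively into its interior, so equality of the counts makes this map onto. By
-- coprimality c then has lattice distance 1 from every facet: c₁ = 1 and
-- cᵢ₊₁sᵢ = cᵢsᵢ₊₁ + 1. Such c exists iff sᵢ divides sᵢ₋₁ + sᵢ₊₁ for all i (with s₀ = 1),
-- which is what being u-generated says.
module Submission where

open import Defs
open import Data.Bool using (Bool; true; false; _∧_; if_then_else_)
open import Data.Bool.Properties using (∧-assoc)
open import Data.Integer as ℤ using (ℤ; +_; -[1+_]; 1ℤ; 0ℤ; _/ℕ_)
open import Data.Integer.DivMod using ([n/ℕd]*d≤n; n<s[n/ℕd]*d)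
import Data.Integer.Properties as ℤₚ
open import Data.Integer.Tactic.RingSolver using (solve-∀)
open import Data.List using (List; []; _∷_; _++_; map; concatMap; filter; length; foldr; applyUpTo)
open import Data.List.Properties using (filter-++; length-++; map-applyUpTo)
open import Data.Maybe using (Maybe; just; nothing)
open import Data.Nat as ℕ using (ℕ; zero; suc; z≤n; s≤s; NonZero; _≤_; _<_; _≤?_)
open import Data.Nat.Combinatorics using (_C_; nCk+nC[k+1]≡[n+1]C[k+1]; k>n⇒nCk≡0)
open import Data.Nat.Coprimality using (Coprime; coprime-Bézout; coprime-divisor; gcd≡1⇒coprime)
open import Data.Nat.Divisibility using (_∣_; divides; ∣m+n∣m⇒∣n; ∣m⇒∣m*n; ∣n⇒∣m*n; ∣1⇒≡1)
open import Data.Nat.DivMod using (m*n/n≡m; m/n*n≡m; m/n*n≤m; /-monoˡ-≤)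
open import Data.Nat.GCD using (gcd; module Bézout)
import Data.Nat.Properties as ℕₚ
import Data.Nat.Tactic.RingSolver as ℕSolver
open import Data.Product using (Σ; _×_; _,_)
open import Data.Sum using (_⊎_; inj₁; inj₂)
open import Data.Vec using (Vec; []; _∷_)
open import Function using (_∘_; id)
open import Function.Bundles using (_⇔_; mk⇔)
open import Relation.Binary.PropositionalEquality
open import Relation.Nullary using (¬_; yes; no; contradiction)
open import Relation.Nullary.Decidable using (T?; ⌊_⌋)

-- Floor division

-- Integer inequalities are rearranged throughout by a ring identity between differences, which the
-- solver can check.
≤-by-difference : ∀ {w x y z} → x ℤ.- w ≡ z ℤ.- y → w ℤ.≤ x → y ℤ.≤ z
≤-by-difference eq w≤x = ℤₚ.0≤i-j⇒j≤i (subst (0ℤ ℤ.≤_) eq (ℤₚ.i≤j⇒0≤j-i w≤x))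

suc-difference : ∀ x y → (1ℤ ℤ.+ y) ℤ.- (1ℤ ℤ.+ x) ≡ y ℤ.- x
suc-difference = solve-∀

module Floor (a : ℤ) (q : ℕ) .{{_ : NonZero q}} where

  -- With `≤/ℕ⇒*≤` this makes `_/ℕ q` right adjoint to multiplication by `q`. It holds because
  -- `m * q` lies strictly below `(1 + a /ℕ q) * q`.
  /ℕ-greatest : ∀ {m} → m ℤ.* + q ℤ.≤ a → m ℤ.≤ a /ℕ q
  /ℕ-greatest {m} mq≤a = ≤-by-difference (suc-difference m (a /ℕ q))
    (ℤₚ.i<j⇒suc[i]≤j (ℤₚ.*-cancelʳ-<-nonNeg {m} {ℤ.suc (a /ℕ q)} (+ q)
      (ℤₚ.≤-<-trans mq≤a (n<s[n/ℕd]*d a q))))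

  ≤/ℕ⇒*≤ : ∀ {m} → m ℤ.≤ a /ℕ q → m ℤ.* + q ℤ.≤ a
  ≤/ℕ⇒*≤ m≤ = ℤₚ.≤-trans (ℤₚ.*-monoʳ-≤-nonNeg (+ q) m≤) ([n/ℕd]*d≤n a q)

  /ℕ-upper : a ℤ.+ 1ℤ ℤ.≤ (a /ℕ q ℤ.+ 1ℤ) ℤ.* + q
  /ℕ-upper = subst₂ ℤ._≤_ (ℤₚ.+-comm 1ℤ a) (cong (ℤ._* + q) (ℤₚ.+-comm 1ℤ (a /ℕ q)))
    (ℤₚ.i<j⇒suc[i]≤j (n<s[n/ℕd]*d a q))

open Floor public

module _ (a : ℤ) (q : ℕ) .{{_ : NonZero q}} where

  /ℕ-shift : ∀ m → (a ℤ.+ m ℤ.* + q) /ℕ q ≡ a /ℕ q ℤ.+ m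
  /ℕ-shift m = ℤₚ.≤-antisym
    (let z = (a ℤ.+ m ℤ.* + q) /ℕ q
         z-m≤ = /ℕ-greatest a q {z ℤ.- m} (≤-by-difference (lem₁ a m (+ q) z)
                  (≤/ℕ⇒*≤ (a ℤ.+ m ℤ.* + q) q ℤₚ.≤-refl))
     in ≤-by-difference (lem₂ (a /ℕ q) z m) z-m≤)
    (/ℕ-greatest (a ℤ.+ m ℤ.* + q) q
      (≤-by-difference (lem₃ a m (+ q) (a /ℕ q)) (≤/ℕ⇒*≤ a q ℤₚ.≤-refl)))
    where
    lem₁ : ∀ a m q z → (a ℤ.+ m ℤ.* q) ℤ.- z ℤ.* q ≡ a ℤ.- (z ℤ.- m) ℤ.* q
    lem₁ = solve-∀
    lem₂ : ∀ x z m → x ℤ.- (z ℤ.- m) ≡ (x ℤ.+ m) ℤ.- z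
    lem₂ = solve-∀
    lem₃ : ∀ a m q x → a ℤ.- x ℤ.* q ≡ (a ℤ.+ m ℤ.* q) ℤ.- (x ℤ.+ m) ℤ.* q
    lem₃ = solve-∀

  -- Strict bounds on integers are weak bounds shifted by 1, so negation swaps the two inequalities
  -- that characterise a floor.
  /ℕ-reflect : (ℤ.- a ℤ.- 1ℤ) /ℕ q ≡ ℤ.- 1ℤ ℤ.- a /ℕ q
  /ℕ-reflect = ℤₚ.≤-antisym
    (let z = (ℤ.- a ℤ.- 1ℤ) /ℕ q
         y = a /ℕ q
         zq≤ = ≤/ℕ⇒*≤ (ℤ.- a ℤ.- 1ℤ) q {z} ℤₚ.≤-refl
         y≤ : y ℤ.* + q ℤ.< (ℤ.- z) ℤ.* + q
         y≤ = ℤₚ.suc[i]≤j⇒i<j (ℤₚ.≤-trans (ℤₚ.+-monoʳ-≤ 1ℤ (≤/ℕ⇒*≤ a q ℤₚ.≤-refl))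
                (≤-by-difference (lem₁ a (+ q) z) zq≤))
     in ≤-by-difference (lem₂ y z)
          (ℤₚ.i<j⇒suc[i]≤j (ℤₚ.*-cancelʳ-<-nonNeg {y} {ℤ.- z} (+ q) y≤)))
    (/ℕ-greatest (ℤ.- a ℤ.- 1ℤ) q
      (≤-by-difference (lem₃ a (+ q) (a /ℕ q)) (/ℕ-upper a q)))
    where
    lem₁ : ∀ a q z → (ℤ.- a ℤ.- 1ℤ) ℤ.- z ℤ.* q ≡ (ℤ.- z) ℤ.* q ℤ.- (1ℤ ℤ.+ a)
    lem₁ = solve-∀
    lem₂ : ∀ y z → ℤ.- z ℤ.- (1ℤ ℤ.+ y) ≡ (ℤ.- 1ℤ ℤ.- y) ℤ.- z
    lem₂ = solve-∀
    lem₃ : ∀ a q x → (x ℤ.+ 1ℤ) ℤ.* q ℤ.- (a ℤ.+ 1ℤ) ≡ (ℤ.- a ℤ.- 1ℤ) ℤ.- (ℤ.- 1ℤ ℤ.- x) ℤ.* q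
    lem₃ = solve-∀

-- Difference operators and reciprocity

sgn-suc : ∀ j → sgn (suc j) ≡ ℤ.- sgn j
sgn-suc zero          = refl
sgn-suc (suc zero)    = refl
sgn-suc (suc (suc j)) = sgn-suc j

sgn*sgn : ∀ j → sgn j ℤ.* sgn j ≡ 1ℤ
sgn*sgn zero          = refl
sgn*sgn (suc zero)    = refl
sgn*sgn (suc (suc j)) = sgn*sgn j

-- On coefficient sequences indexed by the integers this is multiplication by `1 - x^s`, so `Δ^ s N`
-- is multiplication by its `N`-th power.
Δ : ℕ → (ℤ → ℤ) → ℤ → ℤ
Δ s h k = h k ℤ.- h (k ℤ.- + s)

Δ^ : ℕ → ℕ → (ℤ → ℤ) → ℤ → ℤ
Δ^ s zero    h = h
Δ^ s (suc N) h = Δ s (Δ^ s N h)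

module _ (s : ℕ) where

  Δ-cong : ∀ {h h′} → h ≗ h′ → Δ s h ≗ Δ s h′
  Δ-cong eq k = cong₂ ℤ._-_ (eq k) (eq (k ℤ.- + s))

  Δ^-cong : ∀ N {h h′} → h ≗ h′ → Δ^ s N h ≗ Δ^ s N h′
  Δ^-cong zero    eq = eq
  Δ^-cong (suc N) eq = Δ-cong (Δ^-cong N eq)

  Δ^-linear : ∀ N a e b k →
    Δ^ s N (λ j → a j ℤ.+ e ℤ.* b j) k ≡ Δ^ s N a k ℤ.+ e ℤ.* Δ^ s N b k
  Δ^-linear zero    a e b k = refl
  Δ^-linear (suc N) a e b k = trans (Δ-cong (Δ^-linear N a e b) k)
    (lem (Δ^ s N a k) e (Δ^ s N b k) (Δ^ s N a (k ℤ.- + s)) (Δ^ s N b (k ℤ.- + s)))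
    where
    lem : ∀ x e y z w → (x ℤ.+ e ℤ.* y) ℤ.- (z ℤ.+ e ℤ.* w) ≡ (x ℤ.- z) ℤ.+ e ℤ.* (y ℤ.- w)
    lem = solve-∀

  Δ^-comm : ∀ N t h → Δ^ s N (Δ t h) ≗ Δ t (Δ^ s N h)
  Δ^-comm zero    t h k = refl
  Δ^-comm (suc N) t h k = trans (Δ-cong (Δ^-comm N t h) k)
    (trans (lem (d k) (d (k ℤ.- + t)) (d (k ℤ.- + s)) (d (k ℤ.- + s ℤ.- + t)))
      (cong (λ j → (d k ℤ.- d (k ℤ.- + s)) ℤ.- (d (k ℤ.- + t) ℤ.- d j)) (swap k (+ s) (+ t))))
    where
    d = Δ^ s N h
    lem : ∀ a b c e → (a ℤ.- b) ℤ.- (c ℤ.- e) ≡ (a ℤ.- c) ℤ.- (b ℤ.- e)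
    lem = solve-∀
    swap : ∀ k s t → k ℤ.- s ℤ.- t ≡ k ℤ.- t ℤ.- s
    swap = solve-∀

  Δ^-translate : ∀ N h b k → Δ^ s N (λ j → h (j ℤ.- b)) k ≡ Δ^ s N h (k ℤ.- b)
  Δ^-translate zero    h b k = refl
  Δ^-translate (suc N) h b k = trans (Δ-cong (Δ^-translate N h b) k)
    (cong (λ j → Δ^ s N h (k ℤ.- b) ℤ.- Δ^ s N h j) (swap k (+ s) b))
    where
    swap : ∀ k s t → k ℤ.- s ℤ.- t ≡ k ℤ.- t ℤ.- s
    swap = solve-∀

  -- Reflection swaps the two terms of each difference. Every application therefore costs one sign
  -- and moves the centre by `s`.
  Δ^-reflect : ∀ N h c k →
    Δ^ s N (λ j → h (c ℤ.- j)) k ≡ sgn N ℤ.* Δ^ s N h (c ℤ.+ + N ℤ.* + s ℤ.- k)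
  Δ^-reflect zero    h c k = trans (cong h (lem c (+ s) k)) (sym (ℤₚ.*-identityˡ _))
    where
    lem : ∀ c s k → c ℤ.- k ≡ c ℤ.+ 0ℤ ℤ.* s ℤ.- k
    lem = solve-∀
  Δ^-reflect (suc N) h c k = begin
    Δ s (Δ^ s N (λ j → h (c ℤ.- j))) k
      ≡⟨ Δ-cong (Δ^-reflect N h c) k ⟩
    sgn N ℤ.* d (c ℤ.+ + N ℤ.* + s ℤ.- k) ℤ.- sgn N ℤ.* d (c ℤ.+ + N ℤ.* + s ℤ.- (k ℤ.- + s))
      ≡⟨ cong₂ (λ x y → sgn N ℤ.* d x ℤ.- sgn N ℤ.* d y)
           (lem₁ c (+ N) (+ s) k) (lem₂ c (+ N) (+ s) k) ⟩
    sgn N ℤ.* d (c ℤ.+ (1ℤ ℤ.+ + N) ℤ.* + s ℤ.- k ℤ.- + s)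
      ℤ.- sgn N ℤ.* d (c ℤ.+ (1ℤ ℤ.+ + N) ℤ.* + s ℤ.- k)
      ≡⟨ lem₃ (sgn N) _ _ ⟩
    ℤ.- sgn N ℤ.* Δ s d (c ℤ.+ (1ℤ ℤ.+ + N) ℤ.* + s ℤ.- k)
      ≡⟨ cong (ℤ._* Δ s d (c ℤ.+ (1ℤ ℤ.+ + N) ℤ.* + s ℤ.- k)) (sgn-suc N) ⟨
    sgn (suc N) ℤ.* Δ s d (c ℤ.+ + suc N ℤ.* + s ℤ.- k) ∎
    where
    open ≡-Reasoning
    d = Δ^ s N h
    lem₁ : ∀ c N s k → c ℤ.+ N ℤ.* s ℤ.- k ≡ c ℤ.+ (1ℤ ℤ.+ N) ℤ.* s ℤ.- k ℤ.- s
    lem₁ = solve-∀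
    lem₂ : ∀ c N s k → c ℤ.+ N ℤ.* s ℤ.- (k ℤ.- s) ≡ c ℤ.+ (1ℤ ℤ.+ N) ℤ.* s ℤ.- k
    lem₂ = solve-∀
    lem₃ : ∀ e x y → e ℤ.* x ℤ.- e ℤ.* y ≡ ℤ.- e ℤ.* (y ℤ.- x)
    lem₃ = solve-∀

  Δ≡0⇒periodic : ∀ h → (∀ k → Δ s h k ≡ 0ℤ) → ∀ m k → h k ≡ h (k ℤ.- + m ℤ.* + s)
  Δ≡0⇒periodic h Δh≡0 zero    k = cong h (lem k (+ s))
    where
    lem : ∀ k s → k ≡ k ℤ.- 0ℤ ℤ.* s
    lem = solve-∀
  Δ≡0⇒periodic h Δh≡0 (suc m) k = begin
    h k                                ≡⟨ ℤₚ.i-j≡0⇒i≡j _ _ (Δh≡0 k) ⟩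
    h (k ℤ.- + s)                      ≡⟨ Δ≡0⇒periodic h Δh≡0 m (k ℤ.- + s) ⟩
    h (k ℤ.- + s ℤ.- + m ℤ.* + s)      ≡⟨ cong h (lem k (+ m) (+ s)) ⟩
    h (k ℤ.- + suc m ℤ.* + s)          ∎
    where
    open ≡-Reasoning
    lem : ∀ k m s → k ℤ.- s ℤ.- m ℤ.* s ≡ k ℤ.- (1ℤ ℤ.+ m) ℤ.* s
    lem = solve-∀

VanishesBelow : ℤ → (ℤ → ℤ) → Set
VanishesBelow K h = ∀ k → k ℤ.≤ K → h k ≡ 0ℤ

i≤∣i∣ : ∀ i → i ℤ.≤ + ℤ.∣ i ∣
i≤∣i∣ (+ n)    = ℤₚ.≤-refl
i≤∣i∣ -[1+ n ] = ℤ.-≤+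

module _ (s : ℕ) where

  Δ-vanishesBelow : ∀ {K h} → VanishesBelow K h → VanishesBelow K (Δ s h)
  Δ-vanishesBelow v k k≤K = cong₂ ℤ._-_ (v k k≤K) (v (k ℤ.- + s) (ℤₚ.≤-trans (ℤₚ.i-j≤i k (+ s)) k≤K))

  Δ^-vanishesBelow : ∀ N {K h} → VanishesBelow K h → VanishesBelow K (Δ^ s N h)
  Δ^-vanishesBelow zero    v = v
  Δ^-vanishesBelow (suc N) v = Δ-vanishesBelow (Δ^-vanishesBelow N v)

  module _ .{{_ : NonZero s}} where

    -- The kernel of `Δ s` consists of `s`-periodic functions. As `s` is at least 1, `m` steps of
    -- length `s` lead from `k` to `K` or below, where `h` is zero.
    Δ-injective : ∀ {K h} → VanishesBelow K h → (∀ k → Δ s h k ≡ 0ℤ) → ∀ k → h k ≡ 0ℤ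
    Δ-injective {K} {h} v Δh≡0 k = trans (Δ≡0⇒periodic s h Δh≡0 m k) (v _ k-ms≤K)
      where
      m = ℤ.∣ k ℤ.- K ∣
      lem : ∀ k K x → x ℤ.- (k ℤ.- K) ≡ K ℤ.- (k ℤ.- x)
      lem = solve-∀
      k-ms≤K : k ℤ.- + m ℤ.* + s ℤ.≤ K
      k-ms≤K = ≤-by-difference (lem k K (+ m ℤ.* + s))
        (ℤₚ.≤-trans (i≤∣i∣ (k ℤ.- K)) (subst (+ m ℤ.≤_) (ℤₚ.pos-* m s) (ℤ.+≤+ (ℕₚ.m≤m*n m s))))

    Δ^-injective : ∀ N {K h} → VanishesBelow K h → (∀ k → Δ^ s N h k ≡ 0ℤ) → ∀ k → h k ≡ 0ℤ
    Δ^-injective zero    v eq = eq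
    Δ^-injective (suc N) v eq = Δ^-injective N v (Δ-injective (Δ^-vanishesBelow N v) eq)

    Δ^-injective₂ : ∀ N {K h h′} → VanishesBelow K h → VanishesBelow K h′ →
                    Δ^ s N h ≗ Δ^ s N h′ → h ≗ h′
    Δ^-injective₂ N {h = h} {h′} v v′ eq k = ℤₚ.i-j≡0⇒i≡j _ _ (trans (lem (h k) (h′ k))
      (Δ^-injective N {h = λ j → h j ℤ.+ ℤ.- 1ℤ ℤ.* h′ j}
        (λ j j≤K → cong₂ (λ x y → x ℤ.+ ℤ.- 1ℤ ℤ.* y) (v j j≤K) (v′ j j≤K))
        (λ j → trans (Δ^-linear s N h (ℤ.- 1ℤ) h′ j)
                 (trans (sym (lem (Δ^ s N h j) (Δ^ s N h′ j))) (ℤₚ.i≡j⇒i-j≡0 (eq j)))) k))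
      where
      lem : ∀ x y → x ℤ.- y ≡ x ℤ.+ ℤ.- 1ℤ ℤ.* y
      lem = solve-∀

-- Moving `k` back by `q` moves the floor of `k * p / q` back by exactly `p`, so step `q` outside
-- becomes step `p` inside.
Δ^-∘floor : ∀ p q .{{_ : NonZero q}} N h k →
  Δ^ q N (λ j → h ((j ℤ.* + p) /ℕ q)) k ≡ Δ^ p N h ((k ℤ.* + p) /ℕ q)
Δ^-∘floor p q zero    h k = refl
Δ^-∘floor p q (suc N) h k = trans (Δ-cong q (Δ^-∘floor p q N h) k)
  (cong (λ j → Δ^ p N h ((k ℤ.* + p) /ℕ q) ℤ.- Δ^ p N h j)
    (trans (cong (_/ℕ q) (lem k (+ p) (+ q))) (/ℕ-shift (k ℤ.* + p) q (ℤ.- + p))))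
  where
  lem : ∀ k p q → (k ℤ.- q) ℤ.* p ≡ k ℤ.* p ℤ.+ (ℤ.- p) ℤ.* q
  lem = solve-∀

-- Partial sums over the integers and the counting functions built from them

prefixSum : (ℕ → ℕ) → ℕ → ℕ
prefixSum h zero    = h 0
prefixSum h (suc m) = prefixSum h m ℕ.+ h (suc m)

-- Division of the generating function by `1 - x`. The value 0 at negative bounds makes `T` the
-- inverse of `Δ 1` on functions supported on nonnegative integers (`Δ-T`).
T : (ℤ → ℕ) → ℤ → ℕ
T f (+ m)    = prefixSum (λ j → f (+ j)) m
T f -[1+ _ ] = 0

Supported : (ℤ → ℕ) → Set
Supported f = ∀ n → f -[1+ n ] ≡ 0

T-negative : ∀ f {k} → k ℤ.< 0ℤ → T f k ≡ 0
T-negative f {+ k}      k<0 = contradiction k<0 ℤₚ.+≮0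
T-negative f { -[1+ _ ]} _  = refl

T-vanishesBelow : ∀ f → VanishesBelow (ℤ.- 1ℤ) (λ k → + T f k)
T-vanishesBelow f k k≤-1 = cong +_ (T-negative f (ℤₚ.≤-<-trans k≤-1 ℤ.-<+))

Δ-T : ∀ {f} → Supported f → ∀ k → Δ 1 (λ j → + T f j) k ≡ + f k
Δ-T     sup (+ zero)     = ℤₚ.+-identityʳ _
Δ-T {f} sup (+ suc m)    = trans (cong (ℤ._- + T f (+ m)) (ℤₚ.pos-+ (T f (+ m)) (f (+ suc m))))
                             (lem (+ T f (+ m)) (+ f (+ suc m)))
  where
  lem : ∀ x y → x ℤ.+ y ℤ.- x ≡ y
  lem = solve-∀
Δ-T     sup -[1+ n ]     = cong +_ (sym (sup n))

/ℕ-negative : ∀ {a} q .{{_ : NonZero q}} → a ℤ.< 0ℤ → a /ℕ q ℤ.< 0ℤ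
/ℕ-negative {a} q a<0 = ℤₚ.≰⇒> λ 0≤ → ℤₚ.<⇒≱ a<0 (≤/ℕ⇒*≤ a q {0ℤ} 0≤)

-- The cone of s = (σ 0, …, σ n) is handled through its last coordinate only:
-- f n k and g n k count the points of its closure and interior with last coordinate k.
module Counts (r : ℕ → ℕ) where

  σ : ℕ → ℕ
  σ i = suc (r i)

  f : ℕ → ℤ → ℕ
  f zero    (+ _)    = 1
  f zero    -[1+ _ ] = 0
  f (suc n) k        = T (f n) ((k ℤ.* + σ n) /ℕ σ (suc n))

  g : ℕ → ℤ → ℕ
  g zero    (+ zero)  = 0
  g zero    (+ suc _) = 1
  g zero    -[1+ _ ]  = 0
  g (suc n) k         = T (g n) ((k ℤ.* + σ n ℤ.- 1ℤ) /ℕ σ (suc n))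

  *σ-negative : ∀ n m → -[1+ m ] ℤ.* + σ n ℤ.< 0ℤ
  *σ-negative n m = ℤ.-<+

  f-supported : ∀ n → Supported (f n)
  f-supported zero    m = refl
  f-supported (suc n) m = T-negative (f n) (/ℕ-negative (σ (suc n)) (*σ-negative n m))

  g-nonPositive : ∀ n {k} → k ℤ.≤ 0ℤ → g n k ≡ 0
  g-nonPositive zero    {+ zero}    k≤0 = refl
  g-nonPositive zero    {+ suc k}   (ℤ.+≤+ ())
  g-nonPositive zero    { -[1+ _ ]} k≤0 = refl
  g-nonPositive (suc n) {k}         k≤0 = T-negative (g n) (/ℕ-negative (σ (suc n))
    (ℤₚ.≤-<-trans (ℤₚ.+-monoˡ-≤ (ℤ.- 1ℤ) (ℤₚ.*-monoʳ-≤-nonNeg (+ σ n) k≤0)) ℤ.-<+))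

  g-supported : ∀ n → Supported (g n)
  g-supported n m = g-nonPositive n ℤ.-≤+

  -- F n and I n agree with f n and its partial sums at nonnegative arguments, and
  -- with ± the interior counts at negative ones. Ehrhart–Macdonald reciprocity is
  -- the fact that they are quasi-polynomials, i.e. are killed by Δ^.
  F I : ℕ → ℤ → ℤ
  F n k = + f n k ℤ.+ sgn n ℤ.* + g n (ℤ.- k)
  I n k = + T (f n) k ℤ.+ sgn (suc n) ℤ.* + T (g n) (ℤ.- 1ℤ ℤ.- k)

  F-zero : ∀ k → F 0 k ≡ 1ℤ
  F-zero (+ zero)  = refl
  F-zero (+ suc _) = refl
  F-zero -[1+ _ ]  = refl

  -- By `/ℕ-reflect` the interior floor at `- k` is exactly the argument at which `I n` reads
  -- `T (g n)`, so both halves obey a single recursion.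
  F-suc : ∀ n k → F (suc n) k ≡ I n ((k ℤ.* + σ n) /ℕ σ (suc n))
  F-suc n k = cong (λ j → + f (suc n) k ℤ.+ sgn (suc n) ℤ.* + T (g n) j)
    (trans (cong (_/ℕ σ (suc n)) (lem k (+ σ n))) (/ℕ-reflect (k ℤ.* + σ n) (σ (suc n))))
    where
    lem : ∀ k p → ℤ.- k ℤ.* p ℤ.- 1ℤ ≡ ℤ.- (k ℤ.* p) ℤ.- 1ℤ
    lem = solve-∀

  -- Under reflection a backward difference of `T (g n)` becomes a forward one; hence the sign
  -- `sgn (suc n)` in `I` against `sgn n` in `F`.
  Δ-I : ∀ n → Δ 1 (I n) ≗ F n
  Δ-I n k = begin
    (x ℤ.+ sgn (suc n) ℤ.* y) ℤ.- (x′ ℤ.+ sgn (suc n) ℤ.* + T (g n) (ℤ.- 1ℤ ℤ.- (k ℤ.- 1ℤ)))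
      ≡⟨ cong₂ (λ e j → (x ℤ.+ e ℤ.* y) ℤ.- (x′ ℤ.+ e ℤ.* + T (g n) j)) (sgn-suc n) (lem₁ k) ⟩
    (x ℤ.+ ℤ.- e ℤ.* y) ℤ.- (x′ ℤ.+ ℤ.- e ℤ.* y′)
      ≡⟨ lem₂ x x′ e y y′ ⟩
    (x ℤ.- x′) ℤ.+ e ℤ.* (y′ ℤ.- y)
      ≡⟨ cong₂ (λ a b → a ℤ.+ e ℤ.* b) (Δ-T (f-supported n) k)
           (trans (cong (λ j → y′ ℤ.- + T (g n) j) (lem₃ k)) (Δ-T (g-supported n) (ℤ.- k))) ⟩
    F n k ∎
    where
    open ≡-Reasoning
    e  = sgn n
    x  = + T (f n) k
    x′ = + T (f n) (k ℤ.- 1ℤ)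
    y  = + T (g n) (ℤ.- 1ℤ ℤ.- k)
    y′ = + T (g n) (ℤ.- k)
    lem₁ : ∀ k → ℤ.- 1ℤ ℤ.- (k ℤ.- 1ℤ) ≡ ℤ.- k
    lem₁ = solve-∀
    lem₂ : ∀ x x′ e y y′ → (x ℤ.+ ℤ.- e ℤ.* y) ℤ.- (x′ ℤ.+ ℤ.- e ℤ.* y′) ≡ (x ℤ.- x′) ℤ.+ e ℤ.* (y′ ℤ.- y)
    lem₂ = solve-∀
    lem₃ : ∀ k → ℤ.- 1ℤ ℤ.- k ≡ ℤ.- k ℤ.- 1ℤ
    lem₃ = solve-∀

  mutual
    -- `Δ^-∘floor` trades the step `σ (suc n)` for `σ n`, which reduces the claim to `Δ^-I` one
    -- dimension lower.
    Δ^-F : ∀ n k → Δ^ (σ n) (suc n) (F n) k ≡ 0ℤ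
    Δ^-F zero    k = cong₂ ℤ._-_ (F-zero k) (F-zero (k ℤ.- + σ 0))
    Δ^-F (suc n) k = begin
      Δ^ (σ (suc n)) (suc (suc n)) (F (suc n)) k
        ≡⟨ Δ^-cong (σ (suc n)) (suc (suc n)) (F-suc n) k ⟩
      Δ^ (σ (suc n)) (suc (suc n)) (λ j → I n ((j ℤ.* + σ n) /ℕ σ (suc n))) k
        ≡⟨ Δ^-∘floor (σ n) (σ (suc n)) (suc (suc n)) (I n) k ⟩
      Δ^ (σ n) (suc (suc n)) (I n) ((k ℤ.* + σ n) /ℕ σ (suc n))
        ≡⟨ Δ^-I n _ ⟩
      0ℤ ∎
      where open ≡-Reasoning

    -- Differences commute, so the unit difference of `D` is a difference of `F n` that vanishes.
    -- Thus `D` is constant, and one more `Δ (σ n)` kills it.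
    Δ^-I : ∀ n k → Δ^ (σ n) (suc (suc n)) (I n) k ≡ 0ℤ
    Δ^-I n k = ℤₚ.i≡j⇒i-j≡0 (trans (Δ≡0⇒periodic 1 D Δ₁D≡0 (σ n) k)
      (cong (λ j → D (k ℤ.- j)) (ℤₚ.*-identityʳ (+ σ n))))
      where
      D = Δ^ (σ n) (suc n) (I n)
      Δ₁D≡0 : ∀ k → Δ 1 D k ≡ 0ℤ
      Δ₁D≡0 k = trans (sym (Δ^-comm (σ n) (suc n) 1 (I n) k))
        (trans (Δ^-cong (σ n) (suc n) (Δ-I n) k) (Δ^-F n k))

  -- The cone has dimension `suc n`, so the exponent is its dimension plus one: `H n` is the
  -- h*-vector, extended to all integers, and `G n` its analogue for the interior.
  H G : ℕ → ℤ → ℤ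
  H n = Δ^ (σ n) (suc (suc n)) (λ k → + T (f n) k)
  G n = Δ^ (σ n) (suc (suc n)) (λ k → + T (g n) k)

  -- `Δ^-I` splits by linearity, and `Δ^-reflect` turns the interior half into `G n` read backwards.
  -- Its sign `sgn n`, from `suc (suc n)` differences, meets `sgn (suc n)` from `I n`; the product
  -- is minus one.
  reciprocity : ∀ n k → H n k ≡ G n (ℤ.- 1ℤ ℤ.+ + suc (suc n) ℤ.* + σ n ℤ.- k)
  reciprocity n k = ℤₚ.i-j≡0⇒i≡j _ _ (begin
    H n k ℤ.- G n c                                  ≡⟨ lem₁ (H n k) (G n c) ⟩
    H n k ℤ.+ (ℤ.- 1ℤ) ℤ.* G n c                     ≡⟨ cong (λ e → H n k ℤ.+ (ℤ.- e) ℤ.* G n c) (sgn*sgn n) ⟨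
    H n k ℤ.+ (ℤ.- (sgn n ℤ.* sgn n)) ℤ.* G n c      ≡⟨ lem₂ (H n k) (sgn n) (G n c) ⟩
    H n k ℤ.+ ℤ.- sgn n ℤ.* (sgn n ℤ.* G n c)        ≡⟨ cong (λ e → H n k ℤ.+ e ℤ.* (sgn n ℤ.* G n c)) (sgn-suc n) ⟨
    H n k ℤ.+ sgn (suc n) ℤ.* (sgn n ℤ.* G n c)
      ≡⟨ cong (λ e → H n k ℤ.+ sgn (suc n) ℤ.* e) (Δ^-reflect (σ n) (suc (suc n)) _ (ℤ.- 1ℤ) k) ⟨
    _                                                ≡⟨ Δ^-linear (σ n) (suc (suc n)) _ (sgn (suc n)) _ k ⟨
    Δ^ (σ n) (suc (suc n)) (I n) k                   ≡⟨ Δ^-I n k ⟩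
    0ℤ ∎)
    where
    open ≡-Reasoning
    c = ℤ.- 1ℤ ℤ.+ + suc (suc n) ℤ.* + σ n ℤ.- k
    lem₁ : ∀ x y → x ℤ.- y ≡ x ℤ.+ (ℤ.- 1ℤ) ℤ.* y
    lem₁ = solve-∀
    lem₂ : ∀ x e y → x ℤ.+ (ℤ.- (e ℤ.* e)) ℤ.* y ≡ x ℤ.+ ℤ.- e ℤ.* (e ℤ.* y)
    lem₂ = solve-∀

-- Symmetry of h* and translation of counts

-- The minimum serves `b` of either sign, and it is shared with the untranslated function so that
-- `Δ^-injective₂` applies to the pair.
T-translated-vanishesBelow : ∀ f b → VanishesBelow ((ℤ.- 1ℤ) ℤ.⊓ (b ℤ.- 1ℤ)) (λ k → + T f (k ℤ.- b))
T-translated-vanishesBelow f b k k≤ = T-vanishesBelow f (k ℤ.- b)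
  (≤-by-difference (lem k b) (ℤₚ.≤-trans k≤ (ℤₚ.i⊓j≤j (ℤ.- 1ℤ) (b ℤ.- 1ℤ))))
  where
  lem : ∀ k b → (b ℤ.- 1ℤ) ℤ.- k ≡ ℤ.- 1ℤ ℤ.- (k ℤ.- b)
  lem = solve-∀

T-vanishesBelow-⊓ : ∀ f b → VanishesBelow ((ℤ.- 1ℤ) ℤ.⊓ b) (λ k → + T f k)
T-vanishesBelow-⊓ f b k k≤ = T-vanishesBelow f k (ℤₚ.≤-trans k≤ (ℤₚ.i⊓j≤i (ℤ.- 1ℤ) b))

module _ {f g} (f-sup : Supported f) (g-sup : Supported g) (b : ℤ) where

  private
    Δ-Tf : ∀ k → Δ 1 (λ j → + T f (j ℤ.- b)) k ≡ + f (k ℤ.- b)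
    Δ-Tf k = trans (Δ^-translate 1 1 (λ j → + T f j) b k) (Δ-T f-sup (k ℤ.- b))

  -- Both sides have the same unit difference and vanish far to the left.
  T-translate : (∀ k → g k ≡ f (k ℤ.- b)) → ∀ k → T g k ≡ T f (k ℤ.- b)
  T-translate eq k = ℤₚ.+-injective (Δ^-injective₂ 1 1
    (T-vanishesBelow-⊓ g (b ℤ.- 1ℤ)) (T-translated-vanishesBelow f b)
    (λ j → trans (Δ-T g-sup j) (trans (cong +_ (eq j)) (sym (Δ-Tf j)))) k)

  T-translate⁻¹ : (∀ k → T g k ≡ T f (k ℤ.- b)) → ∀ k → g k ≡ f (k ℤ.- b)
  T-translate⁻¹ eq k = ℤₚ.+-injective (trans (sym (Δ-T g-sup k))
    (trans (Δ-cong 1 (λ j → cong +_ (eq j)) k) (Δ-Tf k)))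

Palindromic : (ℤ → ℤ) → Set
Palindromic h = Σ ℕ λ d → h (+ d) ≢ 0ℤ
  × (∀ k → d ℕ.< k → h (+ k) ≡ 0ℤ)
  × (∀ k → k ℕ.≤ d → h (+ k) ≡ h (+ (d ℕ.∸ k)))

m<n⇒m-n≤-1 : ∀ {m n} → m ℕ.< n → + m ℤ.- + n ℤ.≤ ℤ.- 1ℤ
m<n⇒m-n≤-1 {m} {n} m<n = ≤-by-difference (lem (+ m) (+ n)) (ℤ.+≤+ m<n)
  where
  lem : ∀ m n → n ℤ.- (1ℤ ℤ.+ m) ≡ ℤ.- 1ℤ ℤ.- (m ℤ.- n)
  lem = solve-∀

-- Outside the range from 0 to `d`, the reflection pairs a zero below with a zero above.
palindromic⇒reflection : ∀ {h} → VanishesBelow (ℤ.- 1ℤ) h → ((d , _) : Palindromic h) →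
                         ∀ k → h k ≡ h (+ d ℤ.- k)
palindromic⇒reflection {h} v (d , _ , above , sym-h) -[1+ m ] =
  trans (v _ (ℤ.-≤- z≤n)) (sym (above (d ℕ.+ suc m) (ℕₚ.m<m+n d (s≤s z≤n))))
palindromic⇒reflection {h} v (d , _ , above , sym-h) (+ k) with k ℕ.≤? d
... | yes k≤d = trans (sym-h k k≤d) (cong h (sym (trans (ℤₚ.m-n≡m⊖n d k) (ℤₚ.⊖-≥ k≤d))))
... | no  k≰d = trans (above k (ℕₚ.≰⇒> k≰d)) (sym (v _ (m<n⇒m-n≤-1 (ℕₚ.≰⇒> k≰d))))

-- A nonzero value at 0 rules out a negative `e` and gives the nonzero leading coefficient at `e`.
reflection⇒palindromic : ∀ {h} → VanishesBelow (ℤ.- 1ℤ) h → h 0ℤ ≢ 0ℤ → ∀ e →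
                         (∀ k → h k ≡ h (e ℤ.- k)) → Palindromic h
reflection⇒palindromic {h} v h0≢0 -[1+ m ] refl-h =
  contradiction (trans (refl-h 0ℤ) (v _ (ℤ.-≤- z≤n))) h0≢0
reflection⇒palindromic {h} v h0≢0 (+ d) refl-h = d
  , (λ hd≡0 → h0≢0 (trans (refl-h 0ℤ) (trans (cong h (ℤₚ.+-identityʳ (+ d))) hd≡0)))
  , (λ k d<k → trans (refl-h (+ k)) (v _ (m<n⇒m-n≤-1 d<k)))
  , (λ k k≤d → trans (refl-h (+ k)) (cong h (trans (ℤₚ.m-n≡m⊖n d k) (ℤₚ.⊖-≥ k≤d))))

module Symmetry (r : ℕ → ℕ) (n : ℕ) where
  open Counts r

  private
    c = ℤ.- 1ℤ ℤ.+ + suc (suc n) ℤ.* + σ n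

  H-vanishesBelow : VanishesBelow (ℤ.- 1ℤ) (H n)
  H-vanishesBelow = Δ^-vanishesBelow (σ n) (suc (suc n)) (T-vanishesBelow (f n))

  f-0 : ∀ m → f m 0ℤ ≡ 1
  f-0 zero    = refl
  f-0 (suc m) = f-0 m

  Δ^-0 : ∀ N {h} → VanishesBelow (ℤ.- 1ℤ) h → Δ^ (σ n) N h 0ℤ ≡ h 0ℤ
  Δ^-0 zero    v = refl
  Δ^-0 (suc N) v = trans
    (cong₂ ℤ._-_ (Δ^-0 N v) (Δ^-vanishesBelow (σ n) N v _ (ℤ.-≤- z≤n)))
    (ℤₚ.+-identityʳ _)

  H-0 : H n 0ℤ ≡ 1ℤ
  H-0 = trans (Δ^-0 (suc (suc n)) (T-vanishesBelow (f n))) (cong +_ (f-0 n))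

  palindromic⇒translate : Palindromic (H n) → Σ ℤ λ b → ∀ k → g n k ≡ f n (k ℤ.- b)
  palindromic⇒translate P@(d , _) = b , T-translate⁻¹ (f-supported n) (g-supported n) b
    (λ k → ℤₚ.+-injective (Δ^-injective₂ (σ n) (suc (suc n))
      (T-vanishesBelow-⊓ (g n) (b ℤ.- 1ℤ)) (T-translated-vanishesBelow (f n) b)
      (λ j → begin
        G n j                         ≡⟨ cong (G n) (lem₁ c j) ⟩
        G n (c ℤ.- (c ℤ.- j))         ≡⟨ reciprocity n (c ℤ.- j) ⟨
        H n (c ℤ.- j)                 ≡⟨ palindromic⇒reflection H-vanishesBelow P (c ℤ.- j) ⟩
        H n (+ d ℤ.- (c ℤ.- j))       ≡⟨ cong (H n) (lem₂ (+ d) c j) ⟩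
        H n (j ℤ.- b)                 ≡⟨ Δ^-translate (σ n) (suc (suc n)) _ b j ⟨
        _                             ∎)
      k))
    where
    open ≡-Reasoning
    -- Reciprocity reflects about `c`, symmetry about `d`; the composite of the two reflections is
    -- translation by their difference.
    b = c ℤ.- + d
    lem₁ : ∀ c j → j ≡ c ℤ.- (c ℤ.- j)
    lem₁ = solve-∀
    lem₂ : ∀ d c j → d ℤ.- (c ℤ.- j) ≡ j ℤ.- (c ℤ.- d)
    lem₂ = solve-∀

  translate⇒palindromic : ∀ b → (∀ k → g n k ≡ f n (k ℤ.- b)) → Palindromic (H n)
  translate⇒palindromic b eq = reflection⇒palindromic H-vanishesBelow
    (λ H0≡0 → contradiction (trans (sym H-0) H0≡0) λ ())
    (c ℤ.- b)
    (λ k → begin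
      H n k                                            ≡⟨ reciprocity n k ⟩
      G n (c ℤ.- k)
        ≡⟨ Δ^-cong (σ n) (suc (suc n))
             (λ j → cong +_ (T-translate (f-supported n) (g-supported n) b eq j)) (c ℤ.- k) ⟩
      Δ^ (σ n) (suc (suc n)) (λ j → + T (f n) (j ℤ.- b)) (c ℤ.- k)
        ≡⟨ Δ^-translate (σ n) (suc (suc n)) _ b (c ℤ.- k) ⟩
      H n (c ℤ.- k ℤ.- b)                              ≡⟨ cong (H n) (lem c k b) ⟩
      H n (c ℤ.- b ℤ.- k)                              ∎)
    where
    open ≡-Reasoning
    lem : ∀ c k b → c ℤ.- k ℤ.- b ≡ c ℤ.- b ℤ.- k
    lem = solve-∀

-- Minimal interior points

prefixSum-mono : ∀ {a b} → (∀ j → a j ℕ.≤ b j) → ∀ m → prefixSum a m ℕ.≤ prefixSum b m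
prefixSum-mono a≤b zero    = a≤b 0
prefixSum-mono a≤b (suc m) = ℕₚ.+-mono-≤ (prefixSum-mono a≤b m) (a≤b (suc m))

prefixSum-monoʳ : ∀ a {m n} → m ℕ.≤ n → prefixSum a m ℕ.≤ prefixSum a n
prefixSum-monoʳ a {n = zero}  z≤n = ℕₚ.≤-refl
prefixSum-monoʳ a {n = suc n} m≤1+n with ℕₚ.m≤n⇒m<n∨m≡n m≤1+n
... | inj₁ (s≤s m≤n) = ℕₚ.≤-trans (prefixSum-monoʳ a m≤n) (ℕₚ.m≤m+n _ _)
... | inj₂ refl      = ℕₚ.≤-refl

-- A deficit in one term could not be made up elsewhere. This is the numerical substitute for saying
-- that an injection between sets of equal size is onto.
prefixSum≡⇒≡ : ∀ {a b} → (∀ j → a j ℕ.≤ b j) → ∀ m → prefixSum a m ≡ prefixSum b m →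
               ∀ j → j ℕ.≤ m → a j ≡ b j
prefixSum≡⇒≡ a≤b zero    eq zero z≤n = eq
prefixSum≡⇒≡ {a} {b} a≤b (suc m) eq j j≤1+m = case (ℕₚ.m≤n⇒m<n∨m≡n j≤1+m)
  where
  last : a (suc m) ≡ b (suc m)
  last = ℕₚ.≤-antisym (a≤b (suc m)) (ℕₚ.+-cancelˡ-≤ (prefixSum b m) _ _
    (ℕₚ.≤-trans (ℕₚ.≤-reflexive (sym eq)) (ℕₚ.+-monoˡ-≤ (a (suc m)) (prefixSum-mono a≤b m))))
  case : (j ℕ.< suc m) ⊎ (j ≡ suc m) → a j ≡ b j
  case (inj₁ (s≤s j≤m)) = prefixSum≡⇒≡ a≤b m
    (ℕₚ.+-cancelʳ-≡ (a (suc m)) _ _ (trans eq (cong (prefixSum b m ℕ.+_) (sym last)))) j j≤m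
  case (inj₂ refl)      = last

prefixSum-positive : ∀ a m → 0 ℕ.< prefixSum a m → Σ ℕ λ j → j ℕ.≤ m × 0 ℕ.< a j
prefixSum-positive a zero    pos = 0 , z≤n , pos
prefixSum-positive a (suc m) pos with a (suc m) in eq
... | suc _ = suc m , ℕₚ.≤-refl , subst (0 ℕ.<_) (sym eq) (s≤s z≤n)
... | zero  = let j , j≤m , aj = prefixSum-positive a m (subst (0 ℕ.<_) (ℕₚ.+-identityʳ _) pos)
              in j , ℕₚ.m≤n⇒m≤1+n j≤m , aj

T-mono : ∀ {f g} → (∀ k → f k ℕ.≤ g k) → ∀ k → T f k ℕ.≤ T g k
T-mono f≤g (+ m)    = prefixSum-mono (λ j → f≤g (+ j)) m
T-mono f≤g -[1+ _ ] = z≤n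

T-monoʳ : ∀ f {k l} → k ℤ.≤ l → T f k ℕ.≤ T f l
T-monoʳ f { -[1+ _ ]} {_}   _             = z≤n
T-monoʳ f {+ m}       {+ n} (ℤ.+≤+ m≤n)   = prefixSum-monoʳ (λ j → f (+ j)) m≤n

T-strict : ∀ {f} → (∀ j → 0 ℕ.< f (+ j)) → ∀ {k l} → k ℤ.< l → 0ℤ ℤ.≤ l → T f k ℕ.< T f l
T-strict {f} pos {k} {+ zero}  k<l _ rewrite T-negative f k<l = pos 0
T-strict {f} pos {k} {+ suc m} k<l _ = ℕₚ.≤-trans
  (s≤s (T-monoʳ f {k} {+ m} (ℤₚ.i<j⇒i≤pred[j] k<l))) (ℕₚ.m<m+n (T f (+ m)) (pos (suc m)))

Progression : ℕ → ℕ → ℕ → Set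
Progression p q K = Σ ℤ λ k → Σ ℤ λ m → k ℤ.* + p ℤ.- 1ℤ ≡ m ℤ.* + q × + K ℤ.≤ m

-- At such `k` the floor of `(k * p - 1) / q` is attained without remainder, with a quotient as
-- large as desired. Bézout gives one solution, and adding multiples of `(q , p)` gives the others.
coprime-progression : ∀ {p q} .{{_ : NonZero p}} → Coprime p q → ∀ K → Progression p q K
coprime-progression {p} {q} cop K with bézout (coprime-Bézout cop)
  where
  bézout : Bézout.Identity 1 p q → Σ ℤ λ k → Σ ℤ λ m → k ℤ.* + p ℤ.- 1ℤ ≡ m ℤ.* + q
  bézout (Bézout.+- x y eq) = + x , + y ,
    trans (cong (ℤ._- 1ℤ) (trans (sym (ℤₚ.pos-* x p)) (trans (cong +_ (sym eq)) (cong (λ z → 1ℤ ℤ.+ z) (ℤₚ.pos-* y q)))))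
      (lem (+ y ℤ.* + q))
    where
    lem : ∀ z → 1ℤ ℤ.+ z ℤ.- 1ℤ ≡ z
    lem = solve-∀
  bézout (Bézout.-+ x y eq) = ℤ.- + x , ℤ.- + y ,
    trans (lem (+ x) (+ p)) (trans (cong ℤ.-_ (trans (sym (cong (λ z → 1ℤ ℤ.+ z) (ℤₚ.pos-* x p)))
      (trans (cong +_ eq) (ℤₚ.pos-* y q)))) (ℤₚ.neg-distribˡ-* (+ y) (+ q)))
    where
    lem : ∀ x p → ℤ.- x ℤ.* p ℤ.- 1ℤ ≡ ℤ.- (1ℤ ℤ.+ x ℤ.* p)
    lem = solve-∀
... | k , m , eq = k ℤ.+ R ℤ.* + q , m ℤ.+ R ℤ.* + p ,
    trans (lem₁ k (+ p) R (+ q)) (trans (cong (ℤ._+ R ℤ.* + q ℤ.* + p) eq) (lem₂ m (+ q) R (+ p))) ,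
    ≤-by-difference (lem₃ (+ K) m (+ ℤ.∣ m ∣) (R ℤ.* + p)) (ℤₚ.+-mono-≤ -∣m∣≤m R≤Rp)
  where
  -- Large enough to offset a negative `m` and still reach `K`, since `p` is at least 1.
  R = + K ℤ.+ + ℤ.∣ m ∣
  R≤Rp : R ℤ.≤ R ℤ.* + p
  R≤Rp = subst (R ℤ.≤_) (ℤₚ.pos-* (K ℕ.+ ℤ.∣ m ∣) p) (ℤ.+≤+ (ℕₚ.m≤m*n (K ℕ.+ ℤ.∣ m ∣) p))
  -∣m∣≤m : ℤ.- (+ ℤ.∣ m ∣) ℤ.≤ m
  -∣m∣≤m = subst₂ ℤ._≤_ (cong (λ z → ℤ.- + z) (ℤₚ.∣-i∣≡∣i∣ m)) (ℤₚ.neg-involutive m)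
    (ℤₚ.neg-mono-≤ (i≤∣i∣ (ℤ.- m)))
  lem₁ : ∀ k p R q → (k ℤ.+ R ℤ.* q) ℤ.* p ℤ.- 1ℤ ≡ (k ℤ.* p ℤ.- 1ℤ) ℤ.+ R ℤ.* q ℤ.* p
  lem₁ = solve-∀
  lem₂ : ∀ m q R p → m ℤ.* q ℤ.+ R ℤ.* q ℤ.* p ≡ (m ℤ.+ R ℤ.* p) ℤ.* q
  lem₂ = solve-∀
  lem₃ : ∀ K m a x → (m ℤ.+ x) ℤ.- (ℤ.- a ℤ.+ (K ℤ.+ a)) ≡ (m ℤ.+ x) ℤ.- K
  lem₃ = solve-∀

/ℕ-exact : ∀ m q .{{_ : NonZero q}} → (m ℤ.* + q) /ℕ q ≡ m
/ℕ-exact m q@(suc _) = trans (cong (_/ℕ q) (sym (ℤₚ.+-identityˡ (m ℤ.* + q))))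
  (trans (/ℕ-shift 0ℤ q m) (ℤₚ.+-identityˡ m))

-- Chain n c says that c is the last coordinate of an interior lattice point, and
-- ExactChain n c that moreover this point has lattice distance 1 from every facet.
module Chains (r : ℕ → ℕ) where
  open Counts r

  Chain ExactChain : ℕ → ℕ → Set
  Chain zero    c = 1 ℕ.≤ c
  Chain (suc n) c = Σ ℕ λ c′ → Chain n c′ × c′ ℕ.* σ (suc n) ℕ.< c ℕ.* σ n
  ExactChain zero    c = c ≡ 1
  ExactChain (suc n) c = Σ ℕ λ c′ → ExactChain n c′ × c ℕ.* σ n ≡ suc (c′ ℕ.* σ (suc n))

  -- An exact step gives `(k - c) * σ n = (k * σ n - 1) - c′ * σ (suc n)`, so the two summation
  -- limits differ by exactly `c′`.
  exactChain⇒translate : ∀ n c → ExactChain n c → ∀ k → g n k ≡ f n (k ℤ.- + c)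
  exactChain⇒translate zero    .1 refl (+ zero)        = refl
  exactChain⇒translate zero    .1 refl (+ suc m)       = refl
  exactChain⇒translate zero    .1 refl -[1+ m ]        = refl
  exactChain⇒translate (suc n) c  (c′ , ch , eq) k     = trans
    (T-translate {f n} {g n} (f-supported n) (g-supported n) (+ c′) (exactChain⇒translate n c′ ch)
      ((k ℤ.* + σ n ℤ.- 1ℤ) /ℕ σ (suc n)))
    (cong (T (f n)) (sym (trans (cong (_/ℕ σ (suc n)) split)
      (/ℕ-shift (k ℤ.* + σ n ℤ.- 1ℤ) (σ (suc n)) (ℤ.- + c′)))))
    where
    lem₁ : ∀ k c p → (k ℤ.- c) ℤ.* p ≡ k ℤ.* p ℤ.- c ℤ.* p
    lem₁ = solve-∀
    lem₂ : ∀ a c q → a ℤ.- (1ℤ ℤ.+ c ℤ.* q) ≡ a ℤ.- 1ℤ ℤ.+ ℤ.- c ℤ.* q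
    lem₂ = solve-∀
    split : (k ℤ.- + c) ℤ.* + σ n ≡ k ℤ.* + σ n ℤ.- 1ℤ ℤ.+ ℤ.- + c′ ℤ.* + σ (suc n)
    split = trans (lem₁ k (+ c) (+ σ n))
      (trans (cong (λ z → k ℤ.* + σ n ℤ.- z) (trans (sym (ℤₚ.pos-* c (σ n)))
               (trans (cong +_ eq) (cong (λ z → 1ℤ ℤ.+ z) (ℤₚ.pos-* c′ (σ (suc n)))))))
             (lem₂ (k ℤ.* + σ n) (+ c′) (+ σ (suc n))))

  -- The strict inequality puts the left numerator at or below `(k * σ n - 1) - c′ * σ (suc n)`.
  -- Equality of numerators is the exact case.
  floor-gap : ∀ n {c c′} → c′ ℕ.* σ (suc n) ℕ.< c ℕ.* σ n → ∀ k →
    ((k ℤ.- + c) ℤ.* + σ n) /ℕ σ (suc n) ℤ.≤ (k ℤ.* + σ n ℤ.- 1ℤ) /ℕ σ (suc n) ℤ.- + c′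
  floor-gap n {c} {c′} lt k = ≤-by-difference (lem₁ ((k ℤ.* + p ℤ.- 1ℤ) /ℕ q) z (+ c′))
    (/ℕ-greatest (k ℤ.* + p ℤ.- 1ℤ) q {z ℤ.+ + c′}
      (ℤₚ.≤-trans (≤-by-difference (lem₂ k (+ p) (+ c) z (+ q) (+ c′)) (≤/ℕ⇒*≤ ((k ℤ.- + c) ℤ.* + p) q {z} ℤₚ.≤-refl))
        (≤-by-difference (lem₃ k (+ p) (+ c) (+ q) (+ c′)) lt′)))
    where
    p = σ n
    q = σ (suc n)
    z = ((k ℤ.- + c) ℤ.* + p) /ℕ q
    lt′ : 1ℤ ℤ.+ + c′ ℤ.* + q ℤ.≤ + c ℤ.* + p
    lt′ = subst₂ ℤ._≤_ (cong (λ z → 1ℤ ℤ.+ z) (ℤₚ.pos-* c′ q)) (ℤₚ.pos-* c p) (ℤ.+≤+ lt)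
    lem₁ : ∀ y z c → y ℤ.- (z ℤ.+ c) ≡ y ℤ.- c ℤ.- z
    lem₁ = solve-∀
    lem₂ : ∀ k p c z q c′ → (k ℤ.- c) ℤ.* p ℤ.- z ℤ.* q
         ≡ (k ℤ.* p ℤ.- c ℤ.* p ℤ.+ c′ ℤ.* q) ℤ.- (z ℤ.+ c′) ℤ.* q
    lem₂ = solve-∀
    lem₃ : ∀ k p c q c′ → c ℤ.* p ℤ.- (1ℤ ℤ.+ c′ ℤ.* q)
         ≡ (k ℤ.* p ℤ.- 1ℤ) ℤ.- (k ℤ.* p ℤ.- c ℤ.* p ℤ.+ c′ ℤ.* q)
    lem₃ = solve-∀

  T-f-translate : ∀ n c k → T (λ j → f n (j ℤ.- + c)) k ≡ T (f n) (k ℤ.- + c)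
  T-f-translate n c = T-translate {f n} (f-supported n) (supported c) (+ c) (λ _ → refl)
    where
    supported : ∀ c → Supported (λ j → f n (j ℤ.- + c))
    supported zero    m = f-supported n m
    supported (suc c) m = f-supported n (suc (m ℕ.+ c))

  -- The counting form of the injection that adds an interior point to every cone point: `floor-gap`
  -- compares the summation limits, induction the summands.
  chain⇒≤ : ∀ n c → Chain n c → ∀ k → f n (k ℤ.- + c) ℕ.≤ g n k
  chain⇒≤ zero    (suc c) _ (+ zero)  = z≤n
  chain⇒≤ zero    (suc c) _ -[1+ m ]  = z≤n
  chain⇒≤ zero    (suc c) _ (+ suc m) = f-0≤1 (+ suc m ℤ.- + suc c)
    where
    f-0≤1 : ∀ k → f 0 k ℕ.≤ 1
    f-0≤1 (+ _)    = ℕₚ.≤-refl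
    f-0≤1 -[1+ _ ] = z≤n
  chain⇒≤ (suc n) c (c′ , ch , lt) k  = begin
    T (f n) (((k ℤ.- + c) ℤ.* + σ n) /ℕ σ (suc n))  ≤⟨ T-monoʳ (f n) (floor-gap n {c} {c′} lt k) ⟩
    T (f n) (m ℤ.- + c′)                            ≡⟨ T-f-translate n c′ m ⟨
    T (λ j → f n (j ℤ.- + c′)) m                    ≤⟨ T-mono (chain⇒≤ n c′ ch) m ⟩
    T (g n) m                                       ∎
    where
    open ℕₚ.≤-Reasoning
    m = (k ℤ.* + σ n ℤ.- 1ℤ) /ℕ σ (suc n)

  -- A positive sum has a positive term, whose index is the preceding coordinate of an interior
  -- point.
  g-positive⇒chain : ∀ n k → 0 ℕ.< g n k → Σ ℕ λ c → k ≡ + c × Chain n c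
  g-positive⇒chain zero    (+ suc c)  _   = suc c , refl , s≤s z≤n
  g-positive⇒chain (suc n) -[1+ m ]   pos =
    contradiction (g-supported (suc n) m) (ℕₚ.>⇒≢ pos)
  g-positive⇒chain (suc n) (+ c)      pos
    with (+ c ℤ.* + σ n ℤ.- 1ℤ) /ℕ σ (suc n) in eq
  ... | + M with prefixSum-positive (λ j → g n (+ j)) M pos
  ... | j , j≤M , gj with g-positive⇒chain n (+ j) gj
  ... | .j , refl , ch = c , refl , j , ch , ℤₚ.drop‿+<+ (ℤₚ.suc[i]≤j⇒i<j
      (subst₂ ℤ._≤_ (cong (λ z → 1ℤ ℤ.+ z) (sym (ℤₚ.pos-* j (σ (suc n))))) (sym (ℤₚ.pos-* c (σ n)))
        (≤-by-difference (lem (+ c ℤ.* + σ n) (+ j ℤ.* + σ (suc n)))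
          (≤/ℕ⇒*≤ (+ c ℤ.* + σ n ℤ.- 1ℤ) (σ (suc n)) (subst (+ j ℤ.≤_) (sym eq) (ℤ.+≤+ j≤M))))))
    where
    lem : ∀ x y → x ℤ.- 1ℤ ℤ.- y ≡ x ℤ.- (1ℤ ℤ.+ y)
    lem = solve-∀

  f-positive : ∀ n j → 0 ℕ.< f n (+ j)
  f-positive zero    j = s≤s z≤n
  f-positive (suc n) j = ℕₚ.<-≤-trans (f-positive n 0)
    (T-monoʳ (f n) {0ℤ} (/ℕ-greatest (+ j ℤ.* + σ n) (σ (suc n)) {0ℤ}
      (subst (0ℤ ℤ.≤_) (ℤₚ.pos-* j (σ n)) (ℤ.+≤+ z≤n))))

  -- By chain⇒≤ the counts below can only agree if they agree term by term; coprimality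
  -- provides arbitrarily large k for which floor-gap is tight only for an exact step.
  descend : ∀ n c c′ → Coprime (σ n) (σ (suc n)) → Chain n c′ → c′ ℕ.* σ (suc n) ℕ.< c ℕ.* σ n →
    (∀ k → g (suc n) k ≡ f (suc n) (k ℤ.- + c)) →
    (∀ k → g n k ≡ f n (k ℤ.- + c′)) × c ℕ.* σ n ≡ suc (c′ ℕ.* σ (suc n))
  descend n c c′ cop ch lt eq = termwise , ℕₚ.≤-antisym cp≤1+c′q lt
    where
    p = σ n
    q = σ (suc n)
    outer inner : ℤ → ℤ
    outer k = ((k ℤ.- + c) ℤ.* + p) /ℕ q
    inner k = (k ℤ.* + p ℤ.- 1ℤ) /ℕ q
    gap : ∀ k → outer k ℤ.≤ inner k ℤ.- + c′
    gap = floor-gap n {c} {c′} lt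
    upper : ∀ k → T (f n) (k ℤ.- + c′) ℕ.≤ T (g n) k
    upper k = ℕₚ.≤-trans (ℕₚ.≤-reflexive (sym (T-f-translate n c′ k))) (T-mono (chain⇒≤ n c′ ch) k)
    inner≡ : ∀ k m → k ℤ.* + p ℤ.- 1ℤ ≡ m ℤ.* + q → inner k ≡ m
    inner≡ k m kp-1≡mq = trans (cong (_/ℕ q) kp-1≡mq) (/ℕ-exact m q)

    termwise : ∀ k → g n k ≡ f n (k ℤ.- + c′)
    termwise -[1+ m ] = ℕₚ.≤-antisym
      (ℕₚ.≤-trans (ℕₚ.≤-reflexive (g-supported n m)) z≤n) (chain⇒≤ n c′ ch -[1+ m ])
    termwise (+ j) = from (coprime-progression cop j)
      where
      from : Progression p q j → g n (+ j) ≡ f n (+ j ℤ.- + c′)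
      -- Here `inner k` is `M`, and `eq k` squeezes the dominated sum up to `M` against the
      -- dominating one. They agree, hence so do all terms up to `M`, among them the one at `j`.
      from (k , + M , kp-1≡mq , ℤ.+≤+ j≤M) =
        sym (prefixSum≡⇒≡ (λ i → chain⇒≤ n c′ ch (+ i)) M sums j j≤M)
        where
        sums : T (λ i → f n (i ℤ.- + c′)) (+ M) ≡ T (g n) (+ M)
        sums = trans (T-f-translate n c′ (+ M)) (ℕₚ.≤-antisym (upper (+ M))
          (subst (λ m → T (g n) m ℕ.≤ T (f n) (m ℤ.- + c′)) (inner≡ k (+ M) kp-1≡mq)
            (ℕₚ.≤-trans (ℕₚ.≤-reflexive (eq k)) (T-monoʳ (f n) (gap k)))))

    cp≤1+c′q : c ℕ.* p ℕ.≤ suc (c′ ℕ.* q)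
    cp≤1+c′q = from (coprime-progression cop c′)
      where
      from : Progression p q c′ → c ℕ.* p ℕ.≤ suc (c′ ℕ.* q)
      from (k , m , kp-1≡mq , c′≤m) = ℤₚ.drop‿+≤+
        (subst₂ ℤ._≤_ (sym (ℤₚ.pos-* c p)) (cong (λ z → 1ℤ ℤ.+ z) (sym (ℤₚ.pos-* c′ q)))
          (≤-by-difference difference
            (≤/ℕ⇒*≤ ((k ℤ.- + c) ℤ.* + p) q (ℤₚ.≤-reflexive (sym outer≡)))))
        where
        lem₁ : ∀ k c p m c′ q → (k ℤ.- c) ℤ.* p ℤ.- (m ℤ.- c′) ℤ.* q
             ≡ ((1ℤ ℤ.+ c′ ℤ.* q) ℤ.- c ℤ.* p) ℤ.+ ((k ℤ.* p ℤ.- 1ℤ) ℤ.- m ℤ.* q)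
        lem₁ = solve-∀
        lem₂ : ∀ x y → x ℤ.+ (y ℤ.- y) ≡ x
        lem₂ = solve-∀
        -- As `m - c′` is nonnegative, `T (f n)` increases strictly on reaching it. A smaller
        -- `outer k` would make the closed count too small to equal `T (g n) m`.
        outer≡ : outer k ≡ m ℤ.- + c′
        outer≡ = ℤₚ.≤∧≮⇒≡
          (subst (λ i → outer k ℤ.≤ i ℤ.- + c′) (inner≡ k m kp-1≡mq) (gap k))
          (λ outer< → contradiction
            (ℕₚ.≤-trans (upper m)
              (ℕₚ.≤-reflexive (trans (cong (T (g n)) (sym (inner≡ k m kp-1≡mq))) (eq k))))
            (ℕₚ.<⇒≱ (T-strict (f-positive n) outer< (ℤₚ.i≤j⇒0≤j-i c′≤m))))
        difference : (k ℤ.- + c) ℤ.* + p ℤ.- (m ℤ.- + c′) ℤ.* + q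
                   ≡ 1ℤ ℤ.+ + c′ ℤ.* + q ℤ.- + c ℤ.* + p
        difference = trans (lem₁ k (+ c) (+ p) m (+ c′) (+ q))
          (trans (cong (λ z → 1ℤ ℤ.+ + c′ ℤ.* + q ℤ.- + c ℤ.* + p ℤ.+ (z ℤ.- m ℤ.* + q)) kp-1≡mq)
            (lem₂ (1ℤ ℤ.+ + c′ ℤ.* + q ℤ.- + c ℤ.* + p) (m ℤ.* + q)))

  translate⇒exactChain : ∀ n c → (∀ i → i ℕ.< n → Coprime (σ i) (σ (suc i))) → Chain n c →
    (∀ k → g n k ≡ f n (k ℤ.- + c)) → ExactChain n c
  translate⇒exactChain zero    (suc zero)    cop ch eq = refl
  -- At 1 the interior count is 1, whereas the translated closed count is taken at a negative
  -- argument and is 0.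
  translate⇒exactChain zero    (suc (suc c)) cop ch eq = contradiction (eq 1ℤ) λ ()
  translate⇒exactChain (suc n) c cop (c′ , ch , lt) eq =
    let eq′ , exact = descend n c c′ (cop n ℕₚ.≤-refl) ch lt eq
    in c′ , translate⇒exactChain n c′ (λ i i<n → cop i (ℕₚ.m<n⇒m<1+n i<n)) ch eq′ , exact

-- The definitions of ehr and hstar

-- The partial sums and the summands in the definition of hstar are local to it and
-- cannot be named; here unification recovers them. Turning the recursion bound suc m
-- into a variable w that differs from m, and addition into a variable as well,
-- makes the equation a pattern unification problem.
mutual
  partialSum summand : ℕ → (ℕ → ℕ) → ℕ → ℕ → ℤ
  partialSum = _
  summand    = _

  partialSum-unify : ∀ m s k →
    Maybe (partialSum (suc m) s k m ℤ.+ summand (suc m) s k m ℤ.+ 0ℤ ℤ.+ 0ℤ ≡ hstar (suc m) s k)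
  partialSum-unify m s k with suc m ℕ.* s (suc m) ≤? k | suc (suc m) ℕ.* s (suc m) ≤? k
  ... | yes _ | _     = nothing
  ... | no  _ | yes _ = nothing
  ... | no  _ | no  _ with suc m | ℤ._+_
  ...   | w | _⊕_ = just refl

nC0≡1 : ∀ n → n C 0 ≡ 1
nC0≡1 zero    = refl
nC0≡1 (suc n) = refl

module _ (s : ℕ) (h : ℤ → ℤ) where

  binomialTerm : ℕ → ℤ → ℕ → ℤ
  binomialTerm N k j = sgn j ℤ.* (+ (N C j)) ℤ.* h (k ℤ.- + j ℤ.* + s)

  binomialSum : ℕ → ℕ → ℤ → ℤ
  binomialSum N zero    k = 0ℤ
  binomialSum N (suc M) k = binomialSum N M k ℤ.+ binomialTerm N k M

  binomialSum-pascal : ∀ N M k →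
    binomialSum (suc N) (suc M) k ≡ binomialSum N (suc M) k ℤ.- binomialSum N M (k ℤ.- + s)
  binomialSum-pascal N zero    k = trans
    (cong (λ c → 0ℤ ℤ.+ sgn 0 ℤ.* (+ c) ℤ.* h (k ℤ.- 0ℤ ℤ.* + s)) (sym (nC0≡1 N)))
    (sym (ℤₚ.+-identityʳ _))
  binomialSum-pascal N (suc M) k = begin
    binomialSum (suc N) (suc M) k ℤ.+ sgn (suc M) ℤ.* (+ (suc N C suc M)) ℤ.* h k′
      ≡⟨ cong₂ (λ x c → x ℤ.+ sgn (suc M) ℤ.* c ℤ.* h k′) (binomialSum-pascal N M k)
           (trans (cong +_ (sym (nCk+nC[k+1]≡[n+1]C[k+1] N M))) (ℤₚ.pos-+ (N C M) (N C suc M))) ⟩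
    a ℤ.- b ℤ.+ sgn (suc M) ℤ.* (+ (N C M) ℤ.+ + (N C suc M)) ℤ.* h k′
      ≡⟨ lem a b (sgn (suc M)) (+ (N C M)) (+ (N C suc M)) (h k′) ⟩
    a ℤ.+ sgn (suc M) ℤ.* (+ (N C suc M)) ℤ.* h k′ ℤ.- (b ℤ.+ ℤ.- sgn (suc M) ℤ.* (+ (N C M)) ℤ.* h k′)
      ≡⟨ cong₂ (λ e j → a ℤ.+ sgn (suc M) ℤ.* (+ (N C suc M)) ℤ.* h k′ ℤ.- (b ℤ.+ e ℤ.* (+ (N C M)) ℤ.* h j))
           (trans (cong ℤ.-_ (sgn-suc M)) (ℤₚ.neg-involutive (sgn M))) (lem′ k (+ M) (+ s)) ⟩
    binomialSum N (suc (suc M)) k ℤ.- binomialSum N (suc M) (k ℤ.- + s) ∎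
    where
    open ≡-Reasoning
    k′ = k ℤ.- + suc M ℤ.* + s
    a  = binomialSum N (suc M) k
    b  = binomialSum N M (k ℤ.- + s)
    lem : ∀ a b e x y z → a ℤ.- b ℤ.+ e ℤ.* (x ℤ.+ y) ℤ.* z
        ≡ a ℤ.+ e ℤ.* y ℤ.* z ℤ.- (b ℤ.+ ℤ.- e ℤ.* x ℤ.* z)
    lem = solve-∀
    lem′ : ∀ k m s → k ℤ.- (1ℤ ℤ.+ m) ℤ.* s ≡ k ℤ.- s ℤ.- m ℤ.* s
    lem′ = solve-∀

  Δ^≡binomialSum : ∀ N k → Δ^ s N h k ≡ binomialSum N (suc N) k
  Δ^≡binomialSum zero    k = trans (cong h (lem k (+ s)))
    (sym (trans (ℤₚ.+-identityˡ _) (ℤₚ.*-identityˡ _)))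
    where
    lem : ∀ k s → k ≡ k ℤ.- 0ℤ ℤ.* s
    lem = solve-∀
  Δ^≡binomialSum (suc N) k = begin
    Δ^ s N h k ℤ.- Δ^ s N h (k ℤ.- + s)
      ≡⟨ cong₂ ℤ._-_ (Δ^≡binomialSum N k) (Δ^≡binomialSum N (k ℤ.- + s)) ⟩
    a ℤ.- b
      ≡⟨ lem a b (sgn (suc N)) (h k′) ⟩
    (a ℤ.+ sgn (suc N) ℤ.* 0ℤ ℤ.* h k′) ℤ.- b
      -- The added term has coefficient `N C suc N`, which is zero; it raises the upper limit to the
      -- one in Pascal's rule.
      ≡⟨ cong (λ c → (a ℤ.+ sgn (suc N) ℤ.* (+ c) ℤ.* h k′) ℤ.- b) (k>n⇒nCk≡0 (ℕₚ.n<1+n N)) ⟨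
    binomialSum N (suc (suc N)) k ℤ.- b
      ≡⟨ binomialSum-pascal N (suc N) k ⟨
    binomialSum (suc N) (suc (suc N)) k ∎
    where
    open ≡-Reasoning
    k′ = k ℤ.- + suc N ℤ.* + s
    a  = binomialSum N (suc N) k
    b  = binomialSum N (suc N) (k ℤ.- + s)
    lem : ∀ a b e z → a ℤ.- b ≡ (a ℤ.+ e ℤ.* 0ℤ ℤ.* z) ℤ.- b
    lem = solve-∀

hstar≡Δ^ : ∀ n s h → VanishesBelow (ℤ.- 1ℤ) h → (∀ t → + ehr n s t ≡ h (+ t)) →
           ∀ k → hstar n s k ≡ Δ^ (s n) (suc n) h (+ k)
hstar≡Δ^ n s h v ehr≡ k = trans (sums (suc (suc n))) (sym (Δ^≡binomialSum (s n) h (suc n) (+ k)))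
  where
  shift : ∀ j → + k ℤ.- + j ℤ.* + s n ≡ + k ℤ.- + (j ℕ.* s n)
  shift j = cong (λ x → + k ℤ.- x) (sym (ℤₚ.pos-* j (s n)))
  terms : ∀ j → summand n s k j ≡ binomialTerm (s n) h (suc n) (+ k) j
  terms j with j ℕ.* s n ≤? k
  ... | yes js≤k = cong (sgn j ℤ.* (+ (suc n C j)) ℤ.*_) (trans (ehr≡ (k ℕ.∸ j ℕ.* s n))
    (cong h (sym (trans (shift j) (trans (ℤₚ.m-n≡m⊖n k (j ℕ.* s n)) (ℤₚ.⊖-≥ js≤k))))))
  -- The terms that `hstar` omits are those with a negative argument, where `h` vanishes.
  ... | no  js≰k = sym (trans (cong (sgn j ℤ.* (+ (suc n C j)) ℤ.*_) (trans (cong h (shift j))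
    (v _ (m<n⇒m-n≤-1 (ℕₚ.≰⇒> js≰k))))) (ℤₚ.*-zeroʳ (sgn j ℤ.* (+ (suc n C j)))))
  sums : ∀ M → partialSum n s k M ≡ binomialSum (s n) h (suc n) M (+ k)
  sums zero    = refl
  sums (suc M) = cong₂ ℤ._+_ (sums M) (terms M)

-- Lattice-point counts as nested sums over a box

prefixSum-cong-≤ : ∀ {a b} m → (∀ x → x ℕ.≤ m → a x ≡ b x) → prefixSum a m ≡ prefixSum b m
prefixSum-cong-≤ zero    eq = eq 0 z≤n
prefixSum-cong-≤ (suc m) eq = cong₂ ℕ._+_
  (prefixSum-cong-≤ m (λ x x≤m → eq x (ℕₚ.m≤n⇒m≤1+n x≤m))) (eq (suc m) ℕₚ.≤-refl)

prefixSum-cong : ∀ {a b} → a ≗ b → prefixSum a ≗ prefixSum b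
prefixSum-cong eq m = prefixSum-cong-≤ m (λ x _ → eq x)

prefixSum-suc : ∀ a m → prefixSum a (suc m) ≡ a 0 ℕ.+ prefixSum (a ∘ suc) m
prefixSum-suc a zero    = refl
prefixSum-suc a (suc m) = trans (cong (ℕ._+ a (suc (suc m))) (prefixSum-suc a m))
  (ℕₚ.+-assoc (a 0) _ _)

prefixSum-+ : ∀ a b m → prefixSum (λ j → a j ℕ.+ b j) m ≡ prefixSum a m ℕ.+ prefixSum b m
prefixSum-+ a b zero    = refl
prefixSum-+ a b (suc m) = trans (cong (ℕ._+ (a (suc m) ℕ.+ b (suc m))) (prefixSum-+ a b m))
  (lem (prefixSum a m) (prefixSum b m) (a (suc m)) (b (suc m)))
  where
  lem : ∀ x y z w → x ℕ.+ y ℕ.+ (z ℕ.+ w) ≡ x ℕ.+ z ℕ.+ (y ℕ.+ w)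
  lem = ℕSolver.solve-∀

prefixSum-*ʳ : ∀ a c m → prefixSum (λ j → a j ℕ.* c) m ≡ prefixSum a m ℕ.* c
prefixSum-*ʳ a c zero    = refl
prefixSum-*ʳ a c (suc m) = trans (cong (ℕ._+ a (suc m) ℕ.* c) (prefixSum-*ʳ a c m))
  (sym (ℕₚ.*-distribʳ-+ c (prefixSum a m) (a (suc m))))

prefixSum-restrict : ∀ {a b} M B → (∀ x → x ℕ.≤ M → b x ≡ a x) → (∀ x → M ℕ.< x → b x ≡ 0) →
                     M ℕ.≤ B → prefixSum b B ≡ prefixSum a M
prefixSum-restrict M B eq vanish M≤B with ℕₚ.m≤n⇒m<n∨m≡n M≤B
prefixSum-restrict M .M eq vanish M≤B | inj₂ refl = prefixSum-cong-≤ M eq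
prefixSum-restrict M (suc B) eq vanish _ | inj₁ (s≤s M≤B) =
  trans (cong₂ ℕ._+_ (prefixSum-restrict M B eq vanish M≤B) (vanish (suc B) (s≤s M≤B)))
    (ℕₚ.+-identityʳ _)

𝟙 : Bool → ℕ
𝟙 b = if b then 1 else 0

𝟙-∧ : ∀ b c → 𝟙 (b ∧ c) ≡ 𝟙 b ℕ.* 𝟙 c
𝟙-∧ true  c = sym (ℕₚ.*-identityˡ (𝟙 c))
𝟙-∧ false c = refl

sumBox : ∀ n → ℕ → (Vec ℕ n → ℕ) → ℕ
sumBox zero    B φ = φ []
sumBox (suc n) B φ = prefixSum (λ x → sumBox n B (φ ∘ (x ∷_))) B

sumBox-cong : ∀ n B {φ ψ : Vec ℕ n → ℕ} → φ ≗ ψ → sumBox n B φ ≡ sumBox n B ψ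
sumBox-cong zero    B eq = eq []
sumBox-cong (suc n) B eq = prefixSum-cong (λ x → sumBox-cong n B (eq ∘ (x ∷_))) B

sumBox-+ : ∀ n B (φ ψ : Vec ℕ n → ℕ) →
           sumBox n B (λ v → φ v ℕ.+ ψ v) ≡ sumBox n B φ ℕ.+ sumBox n B ψ
sumBox-+ zero    B φ ψ = refl
sumBox-+ (suc n) B φ ψ = trans
  (prefixSum-cong (λ x → sumBox-+ n B (φ ∘ (x ∷_)) (ψ ∘ (x ∷_))) B)
  (prefixSum-+ (λ x → sumBox n B (φ ∘ (x ∷_))) (λ x → sumBox n B (ψ ∘ (x ∷_))) B)

prefixSum-sumBox : ∀ n B (φ : ℕ → Vec ℕ n → ℕ) M →
  prefixSum (λ x → sumBox n B (φ x)) M ≡ sumBox n B (λ v → prefixSum (λ x → φ x v) M)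
prefixSum-sumBox n B φ zero    = refl
prefixSum-sumBox n B φ (suc M) = trans
  (cong (ℕ._+ sumBox n B (φ (suc M))) (prefixSum-sumBox n B φ M))
  (sym (sumBox-+ n B (λ v → prefixSum (λ x → φ x v) M) (φ (suc M))))

count : ∀ {A : Set} → (A → Bool) → List A → ℕ
count p = length ∘ filter (λ v → T? (p v))

count-++ : ∀ {A : Set} (p : A → Bool) xs ys → count p (xs ++ ys) ≡ count p xs ℕ.+ count p ys
count-++ p xs ys = trans (cong length (filter-++ (λ v → T? (p v)) xs ys))
  (length-++ (filter (λ v → T? (p v)) xs))

count-map : ∀ {A B : Set} (p : B → Bool) (h : A → B) xs → count p (map h xs) ≡ count (p ∘ h) xs
count-map p h []       = refl
count-map p h (x ∷ xs) with p (h x)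
... | true  = cong suc (count-map p h xs)
... | false = count-map p h xs

count-concatMap : ∀ {A : Set} (p : A → Bool) (F : ℕ → List A) h m →
  count p (concatMap F (applyUpTo h (suc m))) ≡ prefixSum (λ j → count p (F (h j))) m
count-concatMap p F h zero    = trans (count-++ p (F (h 0)) []) (ℕₚ.+-identityʳ _)
count-concatMap p F h (suc m) = trans (count-++ p (F (h 0)) _)
  (trans (cong (count p (F (h 0)) ℕ.+_) (count-concatMap p F (h ∘ suc) m))
    (sym (prefixSum-suc (λ j → count p (F (h j))) m)))

count-box : ∀ n B (p : Vec ℕ n → Bool) → count p (box n B) ≡ sumBox n B (𝟙 ∘ p)
count-box zero    B p with p []
... | true  = refl
... | false = refl
count-box (suc n) B p = trans (count-concatMap p (λ x → map (x ∷_) (box n B)) id B)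
  (prefixSum-cong (λ x → trans (count-map p (x ∷_) (box n B)) (count-box n B (p ∘ (x ∷_)))) B)

inCone-∷ : ∀ m S x y (v : Vec ℕ m) → inCone (suc (suc m)) S (x ∷ y ∷ v)
         ≡ ⌊ x ℕ.* S 2 ≤? y ℕ.* S 1 ⌋ ∧ inCone (suc m) (S ∘ suc) (y ∷ v)
inCone-∷ m S x y v = cong (λ bs → ⌊ x ℕ.* S 2 ≤? y ℕ.* S 1 ⌋ ∧ foldr _∧_ true bs)
  (trans (map-applyUpTo suc step m) (sym (map-applyUpTo id (step ∘ suc) m)))
  where
  step : ℕ → Bool
  step j = ⌊ at (x ∷ y ∷ v) (suc j) ℕ.* S (suc (suc j)) ≤? at (x ∷ y ∷ v) (suc (suc j)) ℕ.* S (suc j) ⌋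

𝟙-yes : ∀ {m n} → m ℕ.≤ n → ∀ a → a ℕ.* 𝟙 ⌊ m ≤? n ⌋ ≡ a
𝟙-yes {m} {n} m≤n a with m ≤? n
... | yes _   = ℕₚ.*-identityʳ a
... | no  m≰n = contradiction m≤n m≰n

𝟙-no : ∀ {m n} → ¬ m ℕ.≤ n → ∀ a → a ℕ.* 𝟙 ⌊ m ≤? n ⌋ ≡ 0
𝟙-no {m} {n} m≰n a with m ≤? n
... | yes m≤n = contradiction m≤n m≰n
... | no  _   = ℕₚ.*-zeroʳ a

-- This turns the cone inequality between adjacent coordinates into the floor limit in the recursion
-- for `f`. The weight matters only where the indicator is 1.
prefixSum-floor : ∀ (a w : ℕ → ℕ) B c q → (∀ x → x ℕ.* suc q ℕ.≤ c → w x ≡ a x) →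
  (∀ x → x ℕ.* suc q ℕ.≤ c → x ℕ.≤ B) →
  prefixSum (λ x → w x ℕ.* 𝟙 ⌊ x ℕ.* suc q ≤? c ⌋) B ≡ prefixSum a (c ℕ./ suc q)
prefixSum-floor a w B c q w≡a ≤B = prefixSum-restrict (c ℕ./ suc q) B
  (λ x x≤ → trans (𝟙-yes (below x x≤) (w x)) (w≡a x (below x x≤)))
  (λ x x> → 𝟙-no (λ xq≤c → ℕₚ.<⇒≱ x> 
    (subst (ℕ._≤ c ℕ./ suc q) (m*n/n≡m x (suc q)) (/-monoˡ-≤ (suc q) xq≤c))) (w x))
  (≤B (c ℕ./ suc q) (m/n*n≤m c (suc q)))
  where
  below : ∀ x → x ℕ.≤ c ℕ./ suc q → x ℕ.* suc q ℕ.≤ c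
  below x x≤ = ℕₚ.≤-trans (ℕₚ.*-monoˡ-≤ (suc q) x≤) (m/n*n≤m c (suc q))

-- Transitivity of `x / p ≤ y / q ≤ t / l` with denominators cleared.
*-cross-≤ : ∀ {x y p q l t} .{{_ : NonZero q}} →
            x ℕ.* q ℕ.≤ y ℕ.* p → y ℕ.* l ℕ.≤ t ℕ.* q → x ℕ.* l ℕ.≤ t ℕ.* p
*-cross-≤ {x} {y} {p} {q} {l} {t} xq≤yp yl≤tq = ℕₚ.*-cancelʳ-≤ _ _ q (begin
  x ℕ.* l ℕ.* q   ≡⟨ swap x l q ⟩
  x ℕ.* q ℕ.* l   ≤⟨ ℕₚ.*-monoˡ-≤ l xq≤yp ⟩
  y ℕ.* p ℕ.* l   ≡⟨ swap y p l ⟩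
  y ℕ.* l ℕ.* p   ≤⟨ ℕₚ.*-monoˡ-≤ p yl≤tq ⟩
  t ℕ.* q ℕ.* p   ≡⟨ swap t q p ⟩
  t ℕ.* p ℕ.* q   ∎)
  where
  open ℕₚ.≤-Reasoning
  swap : ∀ a b c → a ℕ.* b ℕ.* c ≡ a ℕ.* c ℕ.* b
  swap = ℕSolver.solve-∀

-- A weight w on the first coordinate, needed only where that coordinate can extend to a
-- point with last coordinate at most t, absorbs the coordinates summed over so far.
sumBox-weighted : ∀ t B m (S ρ : ℕ → ℕ) (F : ℕ → ℤ → ℕ) (w : ℕ → ℕ) →
  (∀ j → j ℕ.≤ m → S (suc j) ≡ suc (ρ j)) →
  (∀ j → j ℕ.≤ m → t ℕ.* S (suc j) ℕ.≤ B) →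
  (∀ j k → F (suc j) k ≡ T (F j) ((k ℤ.* + suc (ρ j)) /ℕ suc (ρ (suc j)))) →
  (∀ x → x ℕ.* S (suc m) ℕ.≤ t ℕ.* S 1 → w x ≡ F 0 (+ x)) →
  sumBox (suc m) B (λ v → w (at v 1) ℕ.* 𝟙 (inCone (suc m) S v ∧ ⌊ at v (suc m) ≤? t ⌋))
    ≡ T (F m) (+ t)
sumBox-weighted t B zero S ρ F w S≡ bound rec w≡ = prefixSum-restrict t B
  (λ x x≤t → trans (𝟙-yes x≤t (w x)) (w≡ x (ℕₚ.*-monoˡ-≤ (S 1) x≤t)))
  (λ x t<x → 𝟙-no (ℕₚ.<⇒≱ t<x) (w x))
  (ℕₚ.≤-trans (ℕₚ.m≤m*n t (suc (ρ 0))) (subst (λ s → t ℕ.* s ℕ.≤ B) (S≡ 0 z≤n) (bound 0 z≤n)))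
sumBox-weighted t B (suc m) S ρ F w S≡ bound rec w≡ = begin
  prefixSum (λ x → sumBox (suc m) B (φ x)) B
    -- Summing the first coordinate innermost, with the others fixed, lets it be absorbed into a
    -- weight on the second.
    ≡⟨ prefixSum-sumBox (suc m) B φ B ⟩
  sumBox (suc m) B (λ v → prefixSum (λ x → φ x v) B)
    ≡⟨ sumBox-cong (suc m) B absorb ⟩
  sumBox (suc m) B (λ v → w′ (at v 1) ℕ.* last v)
    ≡⟨ sumBox-weighted t B m (S ∘ suc) (ρ ∘ suc) (F ∘ suc) w′
         (λ j j≤m → S≡ (suc j) (s≤s j≤m)) (λ j j≤m → bound (suc j) (s≤s j≤m))
         (λ j → rec (suc j)) w′≡ ⟩
  T (F (suc m)) (+ t) ∎
  where
  open ≡-Reasoning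
  φ : ℕ → Vec ℕ (suc m) → ℕ
  φ x v = w x ℕ.* 𝟙 (inCone (suc (suc m)) S (x ∷ v) ∧ ⌊ at (x ∷ v) (suc (suc m)) ≤? t ⌋)
  last : Vec ℕ (suc m) → ℕ
  last v = 𝟙 (inCone (suc m) (S ∘ suc) v ∧ ⌊ at v (suc m) ≤? t ⌋)
  w′ : ℕ → ℕ
  w′ y = prefixSum (λ x → w x ℕ.* 𝟙 ⌊ x ℕ.* S 2 ≤? y ℕ.* S 1 ⌋) B
  absorb : ∀ v → prefixSum (λ x → φ x v) B ≡ w′ (at v 1) ℕ.* last v
  absorb (y ∷ v) = trans (prefixSum-cong (λ x → begin
      w x ℕ.* 𝟙 (inCone (suc (suc m)) S (x ∷ y ∷ v) ∧ end)
        ≡⟨ cong (λ b → w x ℕ.* 𝟙 (b ∧ end)) (inCone-∷ m S x y v) ⟩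
      w x ℕ.* 𝟙 ((first x ∧ rest) ∧ end)   ≡⟨ cong (λ b → w x ℕ.* 𝟙 b) (∧-assoc (first x) rest end) ⟩
      w x ℕ.* 𝟙 (first x ∧ rest ∧ end)     ≡⟨ cong (w x ℕ.*_) (𝟙-∧ (first x) (rest ∧ end)) ⟩
      w x ℕ.* (𝟙 (first x) ℕ.* last (y ∷ v)) ≡⟨ ℕₚ.*-assoc (w x) _ _ ⟨
      w x ℕ.* 𝟙 (first x) ℕ.* last (y ∷ v) ∎) B)
    (prefixSum-*ʳ (λ x → w x ℕ.* 𝟙 (first x)) (last (y ∷ v)) B)
    where
    first : ℕ → Bool
    first x = ⌊ x ℕ.* S 2 ≤? y ℕ.* S 1 ⌋
    rest end : Bool
    rest = inCone (suc m) (S ∘ suc) (y ∷ v)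
    end  = ⌊ at (y ∷ v) (suc m) ≤? t ⌋
  w′≡ : ∀ y → y ℕ.* S (suc (suc m)) ℕ.≤ t ℕ.* S 2 → w′ y ≡ F 1 (+ y)
  w′≡ y yl≤tq rewrite S≡ 1 (s≤s z≤n) = begin
    prefixSum (λ x → w x ℕ.* 𝟙 ⌊ x ℕ.* suc (ρ 1) ≤? y ℕ.* S 1 ⌋) B
      ≡⟨ prefixSum-floor (λ x → F 0 (+ x)) w B (y ℕ.* S 1) (ρ 1)
           (λ x xq≤yp → w≡ x (xl≤tp x xq≤yp))
           -- The last entry of `S` is at least 1, so `x` is at most `t * S 1` and the box does not
           -- truncate the sum.
           (λ x xq≤yp → ℕₚ.≤-trans (subst (λ s → x ℕ.≤ x ℕ.* s) (sym (S≡ (suc m) ℕₚ.≤-refl)) (ℕₚ.m≤m*n x (suc (ρ (suc m)))))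
             (ℕₚ.≤-trans (xl≤tp x xq≤yp) (bound 0 z≤n))) ⟩
    prefixSum (λ x → F 0 (+ x)) ((y ℕ.* S 1) ℕ./ suc (ρ 1))
      ≡⟨ cong (λ s → T (F 0) (+ ((y ℕ.* s) ℕ./ suc (ρ 1)))) (S≡ 0 z≤n) ⟩
    T (F 0) ((+ (y ℕ.* suc (ρ 0))) /ℕ suc (ρ 1))
      ≡⟨ cong (λ a → T (F 0) (a /ℕ suc (ρ 1))) (ℤₚ.pos-* y (suc (ρ 0))) ⟩
    T (F 0) ((+ y ℤ.* + suc (ρ 0)) /ℕ suc (ρ 1))
      ≡⟨ rec 0 (+ y) ⟨
    F 1 (+ y) ∎
    where
    xl≤tp : ∀ x → x ℕ.* suc (ρ 1) ℕ.≤ y ℕ.* S 1 → x ℕ.* S (suc (suc m)) ℕ.≤ t ℕ.* S 1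
    xl≤tp x xq≤yp = *-cross-≤ {x} {y} {S 1} {suc (ρ 1)} {t = t} xq≤yp yl≤tq

≤sumFrom : ∀ a k j (s : ℕ → ℕ) → j ℕ.< k → s (a ℕ.+ j) ℕ.≤ sumFrom a k s
≤sumFrom a (suc k) zero    s _         =
  subst (λ i → s i ℕ.≤ s a ℕ.+ sumFrom (suc a) k s) (sym (ℕₚ.+-identityʳ a)) (ℕₚ.m≤m+n (s a) _)
≤sumFrom a (suc k) (suc j) s (s≤s j<k) = ℕₚ.≤-trans
  (subst (λ i → s i ℕ.≤ sumFrom (suc a) k s) (sym (ℕₚ.+-suc a j)) (≤sumFrom (suc a) k j s j<k))
  (ℕₚ.m≤n+m _ _)

module _ (r : ℕ → ℕ) where
  open Counts r

  -- The summation starts from the constant weight 1, which is `f 0` at nonnegative arguments; the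
  -- box size dominates each `t * s (suc j)`.
  ehr≡T : ∀ m s → (∀ j → j ℕ.≤ m → s (suc j) ≡ σ j) → ∀ t → ehr (suc m) s t ≡ T (f m) (+ t)
  ehr≡T m s s≡ t = begin
    count p (box (suc m) B)                                   ≡⟨ count-box (suc m) B p ⟩
    sumBox (suc m) B (𝟙 ∘ p)
      ≡⟨ sumBox-cong (suc m) B (λ v → sym (ℕₚ.*-identityˡ (𝟙 (p v)))) ⟩
    sumBox (suc m) B (λ v → 1 ℕ.* 𝟙 (p v))
      ≡⟨ sumBox-weighted t B m s r f (λ _ → 1) s≡
           (λ j j≤m → ℕₚ.*-monoʳ-≤ t (≤sumFrom 1 (suc m) j s (s≤s j≤m))) (λ _ _ → refl) (λ _ _ → refl) ⟩
    T (f m) (+ t) ∎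
    where
    open ≡-Reasoning
    B = t ℕ.* sumFrom 1 (suc m) s
    p : Vec ℕ (suc m) → Bool
    p v = inCone (suc m) s v ∧ ⌊ at v (suc m) ≤? t ⌋

  hstar≡H : ∀ m s → (∀ j → j ℕ.≤ m → s (suc j) ≡ σ j) → ∀ k → hstar (suc m) s k ≡ H m (+ k)
  hstar≡H m s s≡ k = trans
    (hstar≡Δ^ (suc m) s (λ j → + T (f m) j) (T-vanishesBelow (f m)) (λ t → cong +_ (ehr≡T m s s≡ t)) k)
    (cong (λ q → Δ^ q (suc (suc m)) (λ j → + T (f m) j) (+ k)) (s≡ m ℕₚ.≤-refl))

-- u-generated sequences

module Generation (r : ℕ → ℕ) where
  open Counts r
  open Chains r

  -- σ preceded by the value 1, so that the first step s₂ = u₁s₁ − 1 has the shape of the others.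
  prev : ℕ → ℕ
  prev zero    = 1
  prev (suc i) = σ i

  Generated : ℕ → (ℕ → ℕ) → Set
  Generated m u = ∀ i → i < m → u (suc i) ℕ.* σ i ≡ prev i ℕ.+ σ (suc i)

  exactChain⇒∣ : ∀ m c → ExactChain m c → ∀ i → i < m → σ i ∣ prev i ℕ.+ σ (suc i)
  exactChain⇒∣ (suc m) c (c′ , ch , eq) i i<1+m with ℕₚ.m≤n⇒m<n∨m≡n i<1+m
  exactChain⇒∣ (suc m) c (c′ , ch , eq) i _ | inj₁ (s≤s i<m) = exactChain⇒∣ m c′ ch i i<m
  exactChain⇒∣ (suc zero) c (.1 , refl , eq) .0 _ | inj₂ refl =
    divides c (sym (trans eq (cong suc (ℕₚ.*-identityˡ (σ 1)))))
  exactChain⇒∣ (suc (suc m)) c (c′ , (c″ , ch , eq′) , eq) .(suc m) _ | inj₂ refl =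
    -- Adding the two exact steps around `q` shows that `q` divides `c′ * (σ m + t)`. The earlier
    -- step writes 1 as a combination of `c′` and `q`, so `c′` can be cancelled.
    coprime-divisor coprime (divides (c″ ℕ.+ c) (begin
      c′ ℕ.* (σ m ℕ.+ t)               ≡⟨ ℕₚ.*-distribˡ-+ c′ (σ m) t ⟩
      c′ ℕ.* σ m ℕ.+ c′ ℕ.* t          ≡⟨ cong (ℕ._+ c′ ℕ.* t) eq′ ⟩
      suc (c″ ℕ.* q) ℕ.+ c′ ℕ.* t      ≡⟨ ℕₚ.+-suc (c″ ℕ.* q) (c′ ℕ.* t) ⟨
      c″ ℕ.* q ℕ.+ suc (c′ ℕ.* t)      ≡⟨ cong (c″ ℕ.* q ℕ.+_) eq ⟨
      c″ ℕ.* q ℕ.+ c ℕ.* q             ≡⟨ ℕₚ.*-distribʳ-+ q c″ c ⟨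
      (c″ ℕ.+ c) ℕ.* q                 ∎))
    where
    open ≡-Reasoning
    q = σ (suc m)
    t = σ (suc (suc m))
    coprime : Coprime q c′
    coprime {d} (d∣q , d∣c′) = ∣1⇒≡1 (∣m+n∣m⇒∣n
      (subst (d ∣_) (trans eq′ (ℕₚ.+-comm 1 (c″ ℕ.* q))) (∣m⇒∣m*n (σ m) d∣c′))
      (∣n⇒∣m*n c″ d∣q))

  ExtendsChain : ℕ → ℕ → Set
  ExtendsChain m c = ∀ u t → u ℕ.* σ m ≡ prev m ℕ.+ t → Σ ℕ λ c⁺ → c⁺ ℕ.* σ m ≡ suc (c ℕ.* t)

  -- The coordinates of the interior point obey the same three-term recurrence as the sequence, so
  -- the next one is `c * u ∸ c′`. By `cuq` the truncated subtraction loses nothing after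
  -- multiplication by `q`.
  exactChain-extends : ∀ m c → ExactChain m c → ExtendsChain m c
  exactChain-extends zero    .1 refl u t eq = u , trans eq (cong suc (sym (ℕₚ.*-identityˡ t)))
  exactChain-extends (suc m) c  (c′ , ch , eq′) u t eq = c ℕ.* u ℕ.∸ c′ , (begin
    (c ℕ.* u ℕ.∸ c′) ℕ.* q                         ≡⟨ ℕₚ.*-distribʳ-∸ q (c ℕ.* u) c′ ⟩
    c ℕ.* u ℕ.* q ℕ.∸ c′ ℕ.* q                     ≡⟨ cong (ℕ._∸ c′ ℕ.* q) cuq ⟩
    suc (c ℕ.* t) ℕ.+ c′ ℕ.* q ℕ.∸ c′ ℕ.* q        ≡⟨ ℕₚ.m+n∸n≡m (suc (c ℕ.* t)) (c′ ℕ.* q) ⟩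
    suc (c ℕ.* t)                                  ∎)
    where
    open ≡-Reasoning
    q = σ (suc m)
    cuq : c ℕ.* u ℕ.* q ≡ suc (c ℕ.* t) ℕ.+ c′ ℕ.* q
    cuq = begin
      c ℕ.* u ℕ.* q                  ≡⟨ ℕₚ.*-assoc c u q ⟩
      c ℕ.* (u ℕ.* q)                ≡⟨ cong (c ℕ.*_) eq ⟩
      c ℕ.* (σ m ℕ.+ t)              ≡⟨ ℕₚ.*-distribˡ-+ c (σ m) t ⟩
      c ℕ.* σ m ℕ.+ c ℕ.* t          ≡⟨ cong (ℕ._+ c ℕ.* t) eq′ ⟩
      suc (c′ ℕ.* q) ℕ.+ c ℕ.* t     ≡⟨ cong suc (ℕₚ.+-comm (c′ ℕ.* q) (c ℕ.* t)) ⟩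
      suc (c ℕ.* t) ℕ.+ c′ ℕ.* q     ∎

  generated⇒exactChain : ∀ m u → Generated m u → Σ ℕ (ExactChain m)
  generated⇒exactChain zero    u gen = 1 , refl
  generated⇒exactChain (suc m) u gen =
    let c , ch = generated⇒exactChain m u (λ i i<m → gen i (ℕₚ.m<n⇒m<1+n i<m))
        c⁺ , eq = exactChain-extends m c ch (u (suc m)) (σ (suc m)) (gen m ℕₚ.≤-refl)
    in c⁺ , c , ch , eq

  exactChain⇒generated : ∀ m c → ExactChain m c →
    Σ (ℕ → ℕ) λ u → (∀ i → 1 ≤ i → i < suc m → 1 ≤ u i) × Generated m u
  exactChain⇒generated m c ch = u , positive , generated
    where
    u : ℕ → ℕ
    u zero    = 0
    u (suc i) = (prev i ℕ.+ σ (suc i)) ℕ./ σ i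
    generated : Generated m u
    generated i i<m = m/n*n≡m (exactChain⇒∣ m c ch i i<m)
    positive : ∀ i → 1 ≤ i → i < suc m → 1 ≤ u i
    positive (suc i) _ (s≤s i<m) with u (suc i) in eq
    ... | suc _ = s≤s z≤n
    -- A zero quotient would make the sum zero; commuting it exposes the successor `σ (suc i)`.
    ... | zero  = contradiction
      (trans (ℕₚ.+-comm (σ (suc i)) (prev i)) (trans (sym (generated i i<m)) (cong (ℕ._* σ i) eq))) λ ()

  difference⇒sum : ∀ a b {x y} → + y ≡ + a ℤ.* + b ℤ.- + x → a ℕ.* b ≡ x ℕ.+ y
  difference⇒sum a b {x} {y} eq = ℤₚ.+-injective (begin
    + (a ℕ.* b)                          ≡⟨ ℤₚ.pos-* a b ⟩
    + a ℤ.* + b                          ≡⟨ lem (+ a ℤ.* + b) (+ x) ⟩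
    + x ℤ.+ (+ a ℤ.* + b ℤ.- + x)        ≡⟨ cong (λ z → + x ℤ.+ z) eq ⟨
    + x ℤ.+ + y                          ≡⟨ ℤₚ.pos-+ x y ⟨
    + (x ℕ.+ y)                          ∎)
    where
    open ≡-Reasoning
    lem : ∀ z x → z ≡ x ℤ.+ (z ℤ.- x)
    lem = solve-∀

  sum⇒difference : ∀ a b {x y} → a ℕ.* b ≡ x ℕ.+ y → + y ≡ + a ℤ.* + b ℤ.- + x
  sum⇒difference a b {x} {y} eq = begin
    + y                       ≡⟨ lem (+ x) (+ y) ⟩
    + x ℤ.+ + y ℤ.- + x       ≡⟨ cong (ℤ._- + x) (ℤₚ.pos-+ x y) ⟨
    + (x ℕ.+ y) ℤ.- + x       ≡⟨ cong (λ z → + z ℤ.- + x) eq ⟨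
    + (a ℕ.* b) ℤ.- + x       ≡⟨ cong (ℤ._- + x) (ℤₚ.pos-* a b) ⟩
    + a ℤ.* + b ℤ.- + x       ∎
    where
    open ≡-Reasoning
    lem : ∀ x y → y ≡ x ℤ.+ y ℤ.- x
    lem = solve-∀

  module _ (m : ℕ) (s : ℕ → ℕ) (s≡ : ∀ j → j ≤ m → s (suc j) ≡ σ j) (u : ℕ → ℕ) where

    uGenerated⇒generated : UGenerated (suc m) u s → Generated m u
    uGenerated⇒generated (first , _) zero i<m =
      subst₂ (λ a b → u 1 ℕ.* a ≡ 1 ℕ.+ b) (s≡ 0 z≤n) (s≡ 1 i<m) (difference⇒sum (u 1) (s 1) (first (s≤s i<m)))
    uGenerated⇒generated (_ , next) (suc i) 1+i<m = begin
      u (suc (suc i)) ℕ.* σ (suc i)          ≡⟨ cong (u (suc (suc i)) ℕ.*_) (s≡ (suc i) (ℕₚ.<⇒≤ 1+i<m)) ⟨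
      u (suc (suc i)) ℕ.* s (suc (suc i))   
        ≡⟨ difference⇒sum (u (suc (suc i))) (s (suc (suc i))) (next (suc (suc i)) (s≤s (s≤s z≤n)) (s≤s 1+i<m)) ⟩
      s (suc i) ℕ.+ s (suc (suc (suc i)))
        ≡⟨ cong₂ ℕ._+_ (s≡ i (ℕₚ.≤-trans (ℕₚ.n≤1+n i) (ℕₚ.<⇒≤ 1+i<m))) (s≡ (suc (suc i)) 1+i<m) ⟩
      σ i ℕ.+ σ (suc (suc i))                ∎
      where open ≡-Reasoning

    generated⇒uGenerated : Generated m u → UGenerated (suc m) u s
    generated⇒uGenerated gen = first , next
      where
      open ≡-Reasoning
      first : 2 ≤ suc m → + s 2 ≡ + u 1 ℤ.* + s 1 ℤ.- + 1
      first (s≤s 1≤m) = sum⇒difference (u 1) (s 1)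
        (subst₂ (λ a b → u 1 ℕ.* a ≡ 1 ℕ.+ b) (sym (s≡ 0 z≤n)) (sym (s≡ 1 1≤m)) (gen 0 1≤m))
      next : ∀ i → 2 ≤ i → i < suc m → + s (suc i) ≡ + u i ℤ.* + s i ℤ.- + s (i ℕ.∸ 1)
      next (suc zero) (s≤s ()) _
      next (suc (suc i)) _ (s≤s 1+i<m) = sum⇒difference (u (suc (suc i))) (s (suc (suc i))) (begin
        u (suc (suc i)) ℕ.* s (suc (suc i))  ≡⟨ cong (u (suc (suc i)) ℕ.*_) (s≡ (suc i) (ℕₚ.<⇒≤ 1+i<m)) ⟩
        u (suc (suc i)) ℕ.* σ (suc i)        ≡⟨ gen (suc i) 1+i<m ⟩
        σ i ℕ.+ σ (suc (suc i))
          ≡⟨ cong₂ ℕ._+_ (s≡ i (ℕₚ.≤-trans (ℕₚ.n≤1+n i) (ℕₚ.<⇒≤ 1+i<m))) (s≡ (suc (suc i)) 1+i<m) ⟨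
        s (suc i) ℕ.+ s (suc (suc (suc i))) ∎)

-- Both implications, after rewriting `s` with terms that are successors

theorem4p3 : (n : ℕ) → 1 ≤ n → (s : ℕ → ℕ)
    → (∀ i → 1 ≤ i → i ≤ n → 1 ≤ s i)
    → (∀ i → 1 ≤ i → i < n → gcd (s i) (s (suc i)) ≡ 1)
    → HStarSymmetric n s
    ⇔ Σ (ℕ → ℕ) (λ u → (∀ i → 1 ≤ i → i < n → 1 ≤ u i) × UGenerated n u s)
theorem4p3 (suc m) _ s positive gcd≡1 = mk⇔ to from
  where
  r : ℕ → ℕ
  -- This shifts indices to start at 0 and makes every `σ i` positive by construction; it agrees
  -- with `s` on the range where `s` is positive by hypothesis.
  r i = ℕ.pred (s (suc i))
  open Counts r
  open Symmetry r m
  open Chains r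
  open Generation r

  s≡ : ∀ j → j ≤ m → s (suc j) ≡ σ j
  s≡ j j≤m = sym (ℕₚ.suc-pred (s (suc j)) {{ℕ.>-nonZero (positive (suc j) (s≤s z≤n) (s≤s j≤m))}})

  coprime : ∀ i → i < m → Coprime (σ i) (σ (suc i))
  coprime i i<m = gcd≡1⇒coprime (subst₂ (λ a b → gcd a b ≡ 1) (s≡ i (ℕₚ.<⇒≤ i<m)) (s≡ (suc i) i<m)
    (gcd≡1 (suc i) (s≤s z≤n) (s≤s i<m)))

  hstar≡ : ∀ k → hstar (suc m) s k ≡ H m (+ k)
  hstar≡ = hstar≡H r m s s≡

  symmetric⇒palindromic : HStarSymmetric (suc m) s → Palindromic (H m)
  symmetric⇒palindromic (d , d≢0 , above , sym-h) = d
    , d≢0 ∘ trans (hstar≡ d)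
    , (λ k d<k → trans (sym (hstar≡ k)) (above k d<k))
    , (λ k k≤d → trans (sym (hstar≡ k)) (trans (sym-h k k≤d) (hstar≡ (d ℕ.∸ k))))

  palindromic⇒symmetric : Palindromic (H m) → HStarSymmetric (suc m) s
  palindromic⇒symmetric (d , d≢0 , above , sym-h) = d
    , d≢0 ∘ trans (sym (hstar≡ d))
    , (λ k d<k → trans (hstar≡ k) (above k d<k))
    , (λ k k≤d → trans (hstar≡ k) (trans (sym-h k k≤d) (sym (hstar≡ (d ℕ.∸ k)))))

  translate⇒chain : ∀ b → (∀ k → g m k ≡ f m (k ℤ.- b)) → Σ ℕ (ExactChain m)
  translate⇒chain b eq =
    -- At `k = b` the closed count is taken at the apex and equals 1, so the interior has a point
    -- with last coordinate `b`; in particular `b` is a natural number.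
    let g-b = trans (eq b) (trans (cong (f m) (ℤₚ.i≡j⇒i-j≡0 {b} refl)) (f-0 m))
        c , b≡c , ch = g-positive⇒chain m b (subst (0 <_) (sym g-b) (s≤s z≤n))
    in c , translate⇒exactChain m c coprime ch
             (λ k → subst (λ z → g m k ≡ f m (k ℤ.- z)) b≡c (eq k))

  to : HStarSymmetric (suc m) s →
       Σ (ℕ → ℕ) (λ u → (∀ i → 1 ≤ i → i < suc m → 1 ≤ u i) × UGenerated (suc m) u s)
  to symmetric =
    let b , eq           = palindromic⇒translate (symmetric⇒palindromic symmetric)
        c , ch           = translate⇒chain b eq
        u , u-pos , gen  = exactChain⇒generated m c ch
    in u , u-pos , generated⇒uGenerated m s s≡ u gen

  from : Σ (ℕ → ℕ) (λ u → (∀ i → 1 ≤ i → i < suc m → 1 ≤ u i) × UGenerated (suc m) u s) →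
         HStarSymmetric (suc m) s
  from (u , _ , ugen) =
    let c , ch = generated⇒exactChain m u (uGenerated⇒generated m s s≡ u ugen)
    in palindromic⇒symmetric (translate⇒palindromic (+ c) (exactChain⇒translate m c ch))
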